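{- For every set $I$, the operations $\mathbb{R}^I\to\mathbb{R}$ that preserve integrability over every finite measure space are exactly those generated by the operations $0$, $+$, $\lor$, $\lambda(\,\cdot\,)$ (for each $\lambda\in\mathbb{R}$), $\curlyvee$ and $1$.
   Context: The listed operations on $\mathbb{R}$ are: the constants $0$ and $1$ (arity $0$), addition, binary supremum $\lor$, multiplication by the scalar $\lambda$, and the operation of countably infinite arity $\curlyvee(y,x_0,x_1,\dots)=\sup_{n\in\omega}\{x_n\land y\}$ (with $\omega=\{0,1,2,\dots\}$). Generation: for sets $\Omega,K$, a function $\tau\colon\mathbb{R}^K\to\mathbb{R}$ and $S\subseteq\mathbb{R}^\Omega$, $S$ is closed under $\tau$ if for every family $(f_i)_{i\in K}$ of elements of $S$ the function $\tau((f_i)_{i\in K})\colon x\mapsto\tau((f_i(x))_{i\in K})$ belongs to $S$. Given a set $\mathcal{C}$ of operations on $\mathbb{R}$ (of possibly different arities), a function $f\colon\mathbb{R}^I\to\mathbb{R}$ is generated by $\mathcal{C}$ if it belongs to the smallest subset of $\mathbb{R}^{\mathbb{R}^I}$ that contains all projections $\pi_i\colon\mathbb{R}^I\to\mathbb{R}$ ($i\in I$) and is closed under each element of $\mathcal{C}$. Preservation: for $p\in[1,+\infty)$ and a measure space $(\Omega,\mathcal{F},\mu)$, $\mathcal{L}^p(\mu)$ is the set of $\mathcal{F}$-measurable $f\colon\Omega\to\mathbb{R}$ with $\int_\Omega|f|^p\,d\mu<\infty$. A function $\tau\colon\mathbb{R}^I\to\mathbb{R}$ preserves $p$-integrability over every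 finite measure space if, for every measure space $(\Omega,\mathcal{F},\mu)$ with $\mu(\Omega)<\infty$, $\mathcal{L}^p(\mu)$ is closed under $\tau$. This condition does not depend on $p\in[1,+\infty)$, and $\tau$ is said to preserve integrability over every finite measure space if it holds for some (equivalently, every) $p\in[1,+\infty)$. -}

module Defs where

open import Algebra.Bundles using (RawMonoid; Semiring; CommutativeRing)
open import Algebra.Structures using (IsCommutativeRing)
import Algebra.Construct.NaturalChoice.Max as NaturalMax
import Algebra.Construct.NaturalChoice.Min as NaturalMin
import Algebra.Definitions.RawMonoid as RawMonoidDefs
import Algebra.Definitions.RawSemiring as RawSemiringDefs
open import Axiom.ExcludedMiddle using (ExcludedMiddle)
open import Data.Fin.Base using (Fin; zero; suc; toℕ)
open import Data.Nat.Base as ℕ using (ℕ; zero; suc)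
open import Data.Product.Base using (∃; ∃-syntax; _×_; _,_; proj₁)
open import Data.Sum.Base using (inj₁; inj₂)
open import Level using (Level; 0ℓ; _⊔_) renaming (suc to lsuc)
open import Relation.Binary.Bundles using (TotalOrder)
open import Relation.Binary.Core using (Rel)
open import Relation.Binary.Structures using (IsTotalOrder)
import Relation.Binary.Construct.Add.Supremum.NonStrict as AddSupremum
import Relation.Binary.Construct.NonStrictToStrict as ToStrict
open import Relation.Binary.PropositionalEquality
  using (_≡_; _≢_; _≗_)
open import Relation.Nullary.Construct.Add.Supremum using (_⁺; [_]; ⊤⁺)
open import Relation.Nullary.Decidable.Core using (yes; no)
open import Relation.Unary using (Pred; U; ∅; ∁; ⋃; _⊢_; _≐_; _⊥_)

private
  variable
    a ℓ ℓ₁ ℓ₂ : Level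

IsLub : {A : Set a} → Rel A ℓ₁ → Pred A ℓ₂ → A → Set (a ⊔ ℓ₁ ⊔ ℓ₂)
IsLub _≤_ P s =
  (∀ x → P x → x ≤ s) × (∀ b → (∀ x → P x → x ≤ b) → s ≤ b)

-- Together with excluded middle, these axioms determine ℝ up to a unique
-- isomorphism.
record CompleteOrderedField : Set₁ where
  infix  8 -_
  infixl 7 _*_
  infixl 6 _+_
  infix  4 _≤_
  field
    ℝ                 : Set
    _+_ _*_           : ℝ → ℝ → ℝ
    -_                : ℝ → ℝ
    0# 1#             : ℝ
    _≤_               : Rel ℝ 0ℓ
    isCommutativeRing : IsCommutativeRing _≡_ _+_ _*_ -_ 0# 1#
    0≢1               : 0# ≢ 1#
    inverse           : ∀ x → x ≢ 0# → ∃[ y ] x * y ≡ 1#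
    isTotalOrder      : IsTotalOrder _≡_ _≤_
    +-monoˡ-≤         : ∀ z {x y} → x ≤ y → x + z ≤ y + z
    *-nonneg          : ∀ {x y} → 0# ≤ x → 0# ≤ y → 0# ≤ x * y
    complete          : (P : Pred ℝ 0ℓ) → ∃ P → (∃[ b ] ∀ x → P x → x ≤ b) →
                        ∃[ s ] IsLub _≤_ P s

-- The σ-algebra generated by a family of subsets.  Equality of subsets is
-- mutual inclusion ≐, so σ-algebras are required to respect it.
data σ⟨_⟩ {X : Set} (G : Pred (Pred X 0ℓ) ℓ) : Pred (Pred X 0ℓ) (lsuc 0ℓ ⊔ ℓ) where
  generator  : ∀ {A} → G A → σ⟨ G ⟩ A
  respects   : ∀ {A B} → A ≐ B → σ⟨ G ⟩ A → σ⟨ G ⟩ B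
  whole      : σ⟨ G ⟩ U
  complement : ∀ {A} → σ⟨ G ⟩ A → σ⟨ G ⟩ (∁ A)
  union      : (A : ℕ → Pred X 0ℓ) → (∀ n → σ⟨ G ⟩ (A n)) → σ⟨ G ⟩ (⋃ ℕ A)

record IsσAlgebra {X : Set} (F : Pred (Pred X 0ℓ) (lsuc 0ℓ)) : Set₁ where
  field
    F-respects   : ∀ {A B} → A ≐ B → F A → F B
    F-whole      : F U
    F-complement : ∀ {A} → F A → F (∁ A)
    F-union      : (A : ℕ → Pred X 0ℓ) → (∀ n → F (A n)) → F (⋃ ℕ A)

module Analysis (em : ExcludedMiddle 0ℓ) (R : CompleteOrderedField) where

  open CompleteOrderedField R public

  commutativeRing : CommutativeRing 0ℓ 0ℓ
  commutativeRing = record { isCommutativeRing = isCommutativeRing }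

  totalOrder : TotalOrder 0ℓ 0ℓ 0ℓ
  totalOrder = record { isTotalOrder = isTotalOrder }

  open TotalOrder totalOrder public using (total)
  open NaturalMax totalOrder public using () renaming (_⊔_ to _∨_)
  open NaturalMin totalOrder public using () renaming (_⊓_ to _∧_)
  open ToStrict (_≡_ {A = ℝ}) _≤_ public using (_<_)
  open RawSemiringDefs (Semiring.rawSemiring (CommutativeRing.semiring commutativeRing)) public
    using (_^_) renaming (_×_ to _·_)

  ∣_∣ : ℝ → ℝ
  ∣ x ∣ = x ∨ (- x)

  -- The value 0# is a junk value for empty or unbounded P.
  sup : Pred ℝ 0ℓ → ℝ
  sup P with em {∃ P × (∃[ b ] ∀ x → P x → x ≤ b)}
  ... | yes (inhabited , bounded) = proj₁ (complete P inhabited bounded)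
  ... | no _                      = 0#

  -- For rational q = m / n, x ^ q is the y ≥ 0 with y ^ n ≡ x ^ m.  The
  -- function q ↦ x ^ q is increasing if x ≥ 1 and decreasing if x ≤ 1, so
  -- the real power x ^ʳ p is the supremum of x ^ q over the rational q ≤ p
  -- in the first case and over the rational q ≥ p in the second.  Only
  -- meant for x ≥ 0 and p > 0.
  infixr 8 _^ʳ_
  _^ʳ_ : ℝ → ℝ → ℝ
  x ^ʳ p with total 1# x
  ... | inj₁ _ = sup λ y → 0# ≤ y × ∃[ m ] ∃[ n ]
                   0 ℕ.< n × m · 1# ≤ (n · 1#) * p × y ^ n ≡ x ^ m
  ... | inj₂ _ = sup λ y → 0# ≤ y × ∃[ m ] ∃[ n ]
                   0 ℕ.< n × (n · 1#) * p ≤ m · 1# × y ^ n ≡ x ^ m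

  Open : Pred (Pred ℝ 0ℓ) 0ℓ
  Open V = ∀ x → V x → ∃[ ε ] 0# < ε × (∀ y → ∣ y + - x ∣ < ε → V y)

  Borel : Pred (Pred ℝ 0ℓ) (lsuc 0ℓ)
  Borel = σ⟨ Open ⟩

  ℝ⁺ : Set
  ℝ⁺ = ℝ ⁺

  open AddSupremum _≤_ public using (_≤⁺_)

  infixl 6 _+⁺_
  _+⁺_ : ℝ⁺ → ℝ⁺ → ℝ⁺
  [ x ] +⁺ [ y ] = [ x + y ]
  [ x ] +⁺ ⊤⁺    = ⊤⁺
  ⊤⁺    +⁺ y     = ⊤⁺

  +⁺-rawMonoid : RawMonoid 0ℓ 0ℓ
  +⁺-rawMonoid = record { Carrier = ℝ⁺ ; _≈_ = _≡_ ; _∙_ = _+⁺_ ; ε = [ 0# ] }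

  open RawMonoidDefs +⁺-rawMonoid public using () renaming (sum to sum⁺)

  -- Only meant for a positive scalar on the left.
  infixl 7 _*⁺_
  _*⁺_ : ℝ → ℝ⁺ → ℝ⁺
  x *⁺ [ y ] = [ x * y ]
  x *⁺ ⊤⁺    = ⊤⁺

  -- μ is total for convenience; its values on nonmeasurable sets are
  -- unconstrained and never used.
  record MeasureSpace : Set₂ where
    field
      Ω          : Set
      F          : Pred (Pred Ω 0ℓ) (lsuc 0ℓ)
      isσAlgebra : IsσAlgebra F
      μ          : Pred Ω 0ℓ → ℝ⁺
      μ-cong     : ∀ {A B} → F A → A ≐ B → μ A ≡ μ B
      μ-nonneg   : ∀ {A} → F A → [ 0# ] ≤⁺ μ A
      μ-empty    : μ ∅ ≡ [ 0# ]
      μ-additive : (A : ℕ → Pred Ω 0ℓ) → (∀ n → F (A n)) →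
                   (∀ m n → m ≢ n → A m ⊥ A n) →
                   IsLub _≤⁺_
                     (λ s → ∃[ n ] s ≡ sum⁺ {n} (λ i → μ (A (toℕ i))))
                     (μ (⋃ ℕ A))

  module _ (M : MeasureSpace) where
    open MeasureSpace M

    Finite : Set
    Finite = ∃[ r ] μ U ≡ [ r ]

    Measurable : (Ω → ℝ) → Set₁
    Measurable f = ∀ B → Borel B → F (f ⊢ B)

    -- The simple function taking the value coeff i on piece i, and 0 off
    -- the union of the pieces.
    record SimpleFunction : Set₁ where
      field
        size             : ℕ
        coeff            : Fin size → ℝ
        piece            : Fin size → Pred Ω 0ℓ
        coeff-positive   : ∀ i → 0# < coeff i
        piece-measurable : ∀ i → F (piece i)
        piece-disjoint   : ∀ i j → i ≢ j → piece i ⊥ piece j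

    ∫ₛ : SimpleFunction → ℝ⁺
    ∫ₛ s = sum⁺ (λ i → coeff i *⁺ μ (piece i))
      where open SimpleFunction s

    -- Pointwise inequality s ≤ f, given that f is nonnegative.
    _Below_ : SimpleFunction → (Ω → ℝ) → Set
    s Below f = ∀ i ω → piece i ω → coeff i ≤ f ω
      where open SimpleFunction s

    -- I is the Lebesgue integral of the nonnegative measurable function f.
    IsIntegral : (Ω → ℝ) → ℝ⁺ → Set₁
    IsIntegral f I =
      IsLub _≤⁺_ (λ v → ∃[ s ] s Below f × v ≡ ∫ₛ s) I

    𝓛 : ℝ → Pred (Ω → ℝ) (lsuc 0ℓ)
    𝓛 p f = Measurable f × ∃[ r ] IsIntegral (λ ω → ∣ f ω ∣ ^ʳ p) [ r ]

  Operation : Set → Set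
  Operation K = (K → ℝ) → ℝ

  ClosedUnder : {X K : Set} → Pred (X → ℝ) ℓ → Operation K → Set ℓ
  ClosedUnder {X = X} {K} S τ =
    (f : K → X → ℝ) → (∀ i → S (f i)) → S (λ x → τ (λ i → f i x))

  PreservesIntegrability : {I : Set} → ℝ → Operation I → Set₂
  PreservesIntegrability p τ =
    (M : MeasureSpace) → Finite M → ClosedUnder (𝓛 M p) τ

  -- Equality of functions is pointwise equality ≗, so the generated set is
  -- required to respect it.
  data Generated (C : (K : Set) → Operation K → Set₁) {I : Set} : Operation I → Set₁ where
    projection : ∀ i → Generated C (λ x → x i)
    closed     : ∀ {K τ} → C K τ → ClosedUnder (Generated C) τ
    pointwise  : ∀ {f g} → f ≗ g → Generated C f → Generated C g

  ⋎ : ℝ → (ℕ → ℝ) → ℝ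
  ⋎ y x = sup λ r → ∃[ n ] r ≡ x n ∧ y

  data BasicOperation : (K : Set) → Operation K → Set₁ where
    zero-op  : BasicOperation (Fin 0) (λ _ → 0#)
    plus-op  : BasicOperation (Fin 2) (λ x → x zero + x (suc zero))
    join-op  : BasicOperation (Fin 2) (λ x → x zero ∨ x (suc zero))
    scale-op : ∀ c → BasicOperation (Fin 1) (λ x → c * x zero)
    -- The arguments y, x₀, x₁, … are indexed by 0, 1, 2, …
    sup-op   : BasicOperation ℕ (λ x → ⋎ (x 0) (λ n → x (suc n)))
    one-op   : BasicOperation (Fin 0) (λ _ → 1#)

module Submission where

-- An operation preserves integrability iff it is measurable for the σ-algebra generated by the
-- coordinates and is bounded by c (1 ∨ |xᵢ₁| ∨ … ∨ |xᵢₙ|) for some c and finitely many coordinates.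
--
-- Preservation ⇒ generation.  The subsets of ℝ^I with generated indicator form a σ-algebra for which
-- the coordinates are measurable.  With the zero measure it is a finite measure space, so τ is
-- measurable, and hence depends on countably many coordinates i₀, i₁, … only.  Were the bound to fail,
-- there would be points xₙ with |τ(xₙ)| > 2ⁿ uₙ, where uₙ is the maximum of 1 and the absolute values of
-- the first n of these coordinates of xₙ; with the other coordinates of xₙ set to 0, all coordinates
-- would be p-integrable on ℕ with weights |τ(xₙ)|⁻ᵖ, but τ would not.
-- A nonnegative measurable function with a generated upper bound g is generated, being the supremum
-- of the functions q 1{τ > q} ∧ g over the rationals q ≥ 0; a shift reduces to this case.
--
-- Generation ⇒ preservation.  Each basic operation preserves measurability and is bounded as above,
-- and only (2v)ᵖ ≤ C vᵖ for v ≥ 1 is needed to bound the integrals.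

open import Defs
open import Algebra.Bundles using (CommutativeRing)
import Algebra.Construct.NaturalChoice.Max as NaturalMax
import Algebra.Construct.NaturalChoice.Min as NaturalMin
import Algebra.Properties.CommutativeSemigroup as CommutativeSemigroupProperties
import Algebra.Properties.CommutativeSemiring.Exp as Powers
import Algebra.Properties.Ring as RingProperties
import Algebra.Properties.Semiring.Mult.TCOptimised as Multiples
import Algebra.Properties.Semiring.Sum as FiniteSums
import Algebra.Solver.Ring as RingSolver
open import Algebra.Solver.Ring.AlmostCommutativeRing
  using (_-Raw-AlmostCommutative⟶_; fromCommutativeRing)
open import Axiom.ExcludedMiddle using (ExcludedMiddle)
open import Data.Empty as Empty using (⊥-elim)
open import Data.Fin.Base as Fin using (Fin; zero; suc; toℕ)
import Data.Fin.Properties as Fin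
open import Data.Integer.Base as ℤ using (ℤ)
import Data.Integer.Properties as ℤ
open import Data.Maybe.Base using (Maybe; just; nothing; maybe′)
open import Data.Nat.Base as ℕ using (ℕ; zero; suc; z≤n; s≤s)
import Data.Nat.Properties as ℕ
open import Data.Product.Base using (∃; ∃-syntax; _×_; _,_; proj₁; proj₂)
open import Data.Sum.Base using (_⊎_; inj₁; inj₂; [_,_]′)
open import Data.Unit.Base using (⊤; tt)
open import Function.Base using (_∘_; case_of_)
open import Function.Bundles using (_⇔_; mk⇔)
open import Level using (0ℓ; Lift; lift) renaming (suc to lsuc)
open import Relation.Binary.Bundles using (TotalOrder)
import Relation.Binary.Construct.Add.Supremum.NonStrict as AddSupremum
import Relation.Binary.PropositionalEquality as ≡
import Relation.Binary.Reasoning.PartialOrder as PartialOrderReasoning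
import Relation.Binary.Reasoning.Setoid as SetoidReasoning
open import Relation.Binary.Structures using (IsTotalOrder)
open import Relation.Nullary using (¬_; Dec; yes; no; contradiction)
open import Relation.Nullary.Construct.Add.Supremum using ([_]; ⊤⁺)
open import Relation.Unary using (Pred; U; ∅; ∁; ⋃; _⊢_; _≐_; _⊥_; _∩_; _∪_; _⊆_)

-- Integer coefficients, unlike coefficients in the ring itself, have a
-- computing equality test, so that terms can cancel.
module IntegerRingSolver {c ℓ} (K : CommutativeRing c ℓ) where
  open CommutativeRing K
  open import Data.Integer.Base using (+_; -[1+_]; _⊖_)
  open RingProperties ring
    using (-‿distribˡ-*; -‿distribʳ-*; -0#≈0#; -‿involutive; -‿+-comm)
  open Multiples semiring using (1+×; ×-homo-+; ×1-homo-*) renaming (_×_ to _×′_)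
  open CommutativeSemigroupProperties +-commutativeSemigroup using (interchange)
  open SetoidReasoning setoid

  -- With this form of multiples `1 ×′ 1#` computes to `1#`, so `1-homo` is `refl` and the literals
  -- of the solver match `0#` and `1#` definitionally.
  embed : ℤ → Carrier
  embed (+ n)    = n ×′ 1#
  embed -[1+ n ] = - (suc n ×′ 1#)

  embed-⊖ : ∀ m n → embed (m ⊖ n) ≈ m ×′ 1# + - (n ×′ 1#)
  embed-⊖ zero    zero    = sym (-‿inverseʳ 0#)
  embed-⊖ zero    (suc n) = sym (+-identityˡ _)
  embed-⊖ (suc m) zero    = sym (trans (+-congˡ -0#≈0#) (+-identityʳ _))
  embed-⊖ (suc m) (suc n) = begin
    embed (suc m ⊖ suc n)                         ≡⟨ ≡.cong embed (ℤ.[1+m]⊖[1+n]≡m⊖n m n) ⟩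
    embed (m ⊖ n)                                 ≈⟨ embed-⊖ m n ⟩
    m ×′ 1# + - (n ×′ 1#)                         ≈⟨ +-identityˡ _ ⟨
    0# + (m ×′ 1# + - (n ×′ 1#))                  ≈⟨ +-congʳ (-‿inverseʳ 1#) ⟨
    (1# + - 1#) + (m ×′ 1# + - (n ×′ 1#))         ≈⟨ interchange 1# (- 1#) _ _ ⟩
    (1# + m ×′ 1#) + (- 1# + - (n ×′ 1#))         ≈⟨ +-congˡ (-‿+-comm 1# _) ⟩
    (1# + m ×′ 1#) + - (1# + n ×′ 1#)             ≈⟨ +-cong (1+× m 1#) (-‿cong (1+× n 1#)) ⟨
    suc m ×′ 1# + - (suc n ×′ 1#)                 ∎

  embed-+ : ∀ i j → embed (i ℤ.+ j) ≈ embed i + embed j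
  embed-+ (+ m)    (+ n)    = ×-homo-+ 1# m n
  embed-+ (+ m)    -[1+ n ] = embed-⊖ m (suc n)
  embed-+ -[1+ m ] (+ n)    = trans (embed-⊖ n (suc m)) (+-comm _ _)
  embed-+ -[1+ m ] -[1+ n ] = begin
    - (suc (suc (m ℕ.+ n)) ×′ 1#)         ≡⟨ ≡.cong (λ k → - (k ×′ 1#)) (ℕ.+-suc (suc m) n) ⟨
    - ((suc m ℕ.+ suc n) ×′ 1#)           ≈⟨ -‿cong (×-homo-+ 1# (suc m) (suc n)) ⟩
    - (suc m ×′ 1# + suc n ×′ 1#)         ≈⟨ -‿+-comm _ _ ⟨
    - (suc m ×′ 1#) + - (suc n ×′ 1#)     ∎

  embed-neg : ∀ i → embed (ℤ.- i) ≈ - embed i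
  embed-neg (+ zero)  = sym -0#≈0#
  embed-neg (+ suc n) = refl
  embed-neg -[1+ n ]  = sym (-‿involutive _)

  embed-pos-* : ∀ m j → embed (+ m ℤ.* j) ≈ m ×′ 1# * embed j
  embed-pos-* m (+ n) = begin
    embed (+ m ℤ.* + n)         ≡⟨ ≡.cong embed (ℤ.pos-* m n) ⟨
    (m ℕ.* n) ×′ 1#             ≈⟨ ×1-homo-* m n ⟩
    m ×′ 1# * n ×′ 1#           ∎
  embed-pos-* m -[1+ n ] = begin
    embed (+ m ℤ.* -[1+ n ])        ≡⟨ ≡.cong embed (ℤ.neg-distribʳ-* (+ m) (+ suc n)) ⟨
    embed (ℤ.- (+ m ℤ.* + suc n))   ≈⟨ embed-neg (+ m ℤ.* + suc n) ⟩
    - embed (+ m ℤ.* + suc n)       ≈⟨ -‿cong (embed-pos-* m (+ suc n)) ⟩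
    - (m ×′ 1# * suc n ×′ 1#)       ≈⟨ -‿distribʳ-* _ _ ⟩
    m ×′ 1# * - (suc n ×′ 1#)       ∎
  embed-* : ∀ i j → embed (i ℤ.* j) ≈ embed i * embed j
  embed-* (+ m)    j = embed-pos-* m j
  embed-* -[1+ m ] j = begin
    embed (-[1+ m ] ℤ.* j)          ≡⟨ ≡.cong embed (ℤ.neg-distribˡ-* (+ suc m) j) ⟨
    embed (ℤ.- (+ suc m ℤ.* j))     ≈⟨ embed-neg (+ suc m ℤ.* j) ⟩
    - embed (+ suc m ℤ.* j)         ≈⟨ -‿cong (embed-pos-* (suc m) j) ⟩
    - (suc m ×′ 1# * embed j)       ≈⟨ -‿distribˡ-* _ _ ⟩
    - (suc m ×′ 1#) * embed j       ∎

  homomorphism : ℤ.+-*-rawRing -Raw-AlmostCommutative⟶ fromCommutativeRing K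
  homomorphism = record
    { ⟦_⟧ = embed ; +-homo = embed-+ ; *-homo = embed-* ; -‿homo = embed-neg
    ; 0-homo = refl ; 1-homo = refl }

  same : ∀ i j → Maybe (embed i ≈ embed j)
  same i j with i ℤ.≟ j
  ... | yes i≡j = just (reflexive (≡.cong embed i≡j))
  ... | no _    = nothing

  open RingSolver ℤ.+-*-rawRing (fromCommutativeRing K) homomorphism same public
    using (Polynomial; con; solve; _:=_; _:+_; _:*_; :-_)

-- Membership in `𝓛` combines measurability with a bound on an integral, and each test space
-- isolates one of the two. Under the zero measure every integral vanishes, so preservation only
-- says that τ, applied to the coordinates, is measurable. On ℕ every set is measurable and only
-- growth is tested: the weight |τ(xₙ)|⁻ᵖ makes each point contribute exactly 1 to the integral of
-- |τ|ᵖ, whereas 2ⁿ uₙ < |τ(xₙ)| and p ≥ 1 leave at most 2⁻ⁿ for uₙᵖ. As uₙ ≥ 1, the total mass is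
-- at most 2. A relevant coordinate is bounded by uₙ for all but finitely many n, which suffices.
-- Hence countable dependence has to come before the growth bound: no sequence of finite maxima
-- reaches uncountably many coordinates.
--
-- The integral is given only as a least upper bound of lower sums, and a real power only as a
-- supremum of rational powers. Linearity of the former and multiplicativity of the latter are
-- avoided: lower sums are split along a measurable set, and powers are compared only under
-- monotonicity and doubling.

module Proof (em : ∀ {ℓ} → ExcludedMiddle ℓ) (R : CompleteOrderedField) where
  open Analysis em R
  open ≡ using (_≡_; _≢_; _≗_; refl; sym; trans; cong; cong₂; subst; subst₂; module ≡-Reasoning)

  -- Ordered field arithmetic

  open CommutativeRing commutativeRing
    using ( +-comm; +-assoc; +-identityˡ; +-identityʳ; -‿inverseʳ
          ; *-comm; *-assoc; *-identityˡ; *-identityʳ; zeroˡ; zeroʳ; distribˡ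
          ; semiring)
  module ⟨+-*⟩ = IntegerRingSolver commutativeRing
  open ⟨+-*⟩ using (solve; con; _:=_; _:+_; _:*_; :-_; Polynomial)

  :0 :1 : ∀ {n} → Polynomial n
  :0 = con (ℤ.+ 0)
  :1 = con (ℤ.+ 1)

  open IsTotalOrder isTotalOrder
    using () renaming (refl to ≤-refl; reflexive to ≤-reflexive; trans to ≤-trans; antisym to ≤-antisym)
  open NaturalMax totalOrder using () renaming
    ( x≤x⊔y to x≤x∨y; x≤y⊔x to y≤x∨y; ⊔-lub to ∨-lub; ⊔-mono-≤ to ∨-mono; ⊔-sel to ∨-sel)
  open NaturalMin totalOrder using () renaming
    ( x⊓y≤x to x∧y≤x; x⊓y≤y to x∧y≤y; ⊓-glb to ∧-glb; ⊓-sel to ∧-sel)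

  module ≤-Reasoning = PartialOrderReasoning (TotalOrder.poset totalOrder)

  <⇒≱ : ∀ {x y} → x < y → ¬ y ≤ x
  <⇒≱ (x≤y , x≢y) y≤x = x≢y (≤-antisym x≤y y≤x)

  ≰⇒> : ∀ {x y} → ¬ x ≤ y → y < x
  ≰⇒> {x} {y} x≰y with total x y
  ... | inj₁ x≤y = contradiction x≤y x≰y
  ... | inj₂ y≤x = y≤x , λ y≡x → x≰y (≤-reflexive (sym y≡x))

  <-≤-trans : ∀ {x y z} → x < y → y ≤ z → x < z
  <-≤-trans x<y y≤z = ≰⇒> λ z≤x → <⇒≱ x<y (≤-trans y≤z z≤x)

  ≤-<-trans : ∀ {x y z} → x ≤ y → y < z → x < z
  ≤-<-trans x≤y y<z = ≰⇒> λ z≤x → <⇒≱ y<z (≤-trans z≤x x≤y)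

  ≤-or-> : ∀ x y → x ≤ y ⊎ y < x
  ≤-or-> x y with em {P = x ≤ y}
  ... | yes x≤y = inj₁ x≤y
  ... | no  x≰y = inj₂ (≰⇒> x≰y)

  ≮⇒≥ : ∀ {x y} → ¬ y < x → x ≤ y
  ≮⇒≥ {x} {y} y≮x with ≤-or-> x y
  ... | inj₁ x≤y = x≤y
  ... | inj₂ y<x = contradiction y<x y≮x

  0≤-diff : ∀ {x y} → x ≤ y → 0# ≤ y + - x
  0≤-diff {x} x≤y = subst (_≤ _) (-‿inverseʳ x) (+-monoˡ-≤ (- x) x≤y)

  diff-0≤ : ∀ {x y c} → 0# ≤ c → y + - x ≡ c → x ≤ y
  diff-0≤ {x} {y} 0≤c refl = subst₂ _≤_ (+-identityˡ x)
    (solve 2 (λ x y → (y :+ :- x) :+ x := y) refl x y) (+-monoˡ-≤ x 0≤c)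

  +-mono : ∀ {x y u v} → x ≤ y → u ≤ v → x + u ≤ y + v
  +-mono {x} {y} {u} {v} x≤y u≤v = ≤-trans (+-monoˡ-≤ u x≤y)
    (subst₂ _≤_ (+-comm u y) (+-comm v y) (+-monoˡ-≤ y u≤v))

  +-nonneg : ∀ {x y} → 0# ≤ x → 0# ≤ y → 0# ≤ x + y
  +-nonneg 0≤x 0≤y = subst (_≤ _) (+-identityˡ 0#) (+-mono 0≤x 0≤y)

  -- An inequality follows from others if its difference is the sum of theirs.
  lin₁ : ∀ {x y a b} → x ≤ y → b + - a ≡ y + - x → a ≤ b
  lin₁ p = diff-0≤ (0≤-diff p)

  lin₂ : ∀ {x y u v a b} → x ≤ y → u ≤ v →
         b + - a ≡ (y + - x) + (v + - u) → a ≤ b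
  lin₂ p q = diff-0≤ (+-nonneg (0≤-diff p) (0≤-diff q))

  lin₁< : ∀ {x y a b} → x < y → b + - a ≡ y + - x → a < b
  lin₁< {x} {y} {a} {b} x<y e = ≰⇒> λ b≤a → <⇒≱ x<y (lin₁ b≤a
    (trans (solve 2 (λ x y → x :+ :- y := :- (y :+ :- x)) refl x y)
    (trans (cong -_ (sym e)) (solve 2 (λ x y → :- (y :+ :- x) := x :+ :- y) refl a b))))

  lin₂< : ∀ {x y u v a b} → x < y → u ≤ v →
          b + - a ≡ (y + - x) + (v + - u) → a < b
  lin₂< {x} {y} {u} {v} {a} {b} x<y u≤v e = ≰⇒> λ b≤a → <⇒≱ x<y (lin₂ b≤a u≤v
    (trans (solve 4 (λ x y u v → x :+ :- y := (:- ((y :+ :- x) :+ (v :+ :- u)) :+ (v :+ :- u))) refl x y u v)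
    (trans (cong (λ z → - z + (v + - u)) (sym e))
      (solve 3 (λ a b w → :- (b :+ :- a) :+ w := a :+ :- b :+ w) refl a b (v + - u)))))

  neg-mono : ∀ {x y} → x ≤ y → - y ≤ - x
  neg-mono {x} {y} p = lin₁ p (solve 2 (λ x y → (:- x) :+ :- (:- y) := y :+ :- x) refl x y)

  neg-involutive : ∀ x → - (- x) ≡ x
  neg-involutive = solve 1 (λ x → :- (:- x) := x) refl

  neg-mono-< : ∀ {x y} → x < y → - y < - x
  neg-mono-< {x} {y} p = lin₁< p (solve 2 (λ x y → (:- x) :+ :- (:- y) := y :+ :- x) refl x y)

  0≤1 : 0# ≤ 1#
  0≤1 with total 0# 1#
  ... | inj₁ 0≤1 = 0≤1
  ... | inj₂ 1≤0 = subst (0# ≤_) (solve 0 ((:0 :+ :- :1) :* (:0 :+ :- :1) := :1) refl)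
                     (*-nonneg (0≤-diff 1≤0) (0≤-diff 1≤0))

  0<1 : 0# < 1#
  0<1 = 0≤1 , 0≢1

  2# : ℝ
  2# = 1# + 1#

  0<2 : 0# < 2#
  0<2 = <-≤-trans 0<1 (diff-0≤ 0≤1 (solve 0 ((:1 :+ :1) :+ :- :1 := :1) refl))

  1≤2 : 1# ≤ 2#
  1≤2 = diff-0≤ 0≤1 (solve 0 ((:1 :+ :1) :+ :- :1 := :1) refl)

  *-monoˡ : ∀ {a x y} → 0# ≤ a → x ≤ y → a * x ≤ a * y
  *-monoˡ {a} {x} {y} 0≤a x≤y = diff-0≤ (*-nonneg 0≤a (0≤-diff x≤y))
    (solve 3 (λ a x y → a :* y :+ :- (a :* x) := a :* (y :+ :- x)) refl a x y)

  *-monoʳ : ∀ {a x y} → 0# ≤ a → x ≤ y → x * a ≤ y * a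
  *-monoʳ {a} {x} {y} 0≤a x≤y = subst₂ _≤_ (*-comm a x) (*-comm a y) (*-monoˡ 0≤a x≤y)

  *-mono : ∀ {x y u v} → 0# ≤ x → 0# ≤ v → x ≤ y → u ≤ v → x * u ≤ y * v
  *-mono 0≤x 0≤v x≤y u≤v = ≤-trans (*-monoˡ 0≤x u≤v) (*-monoʳ 0≤v x≤y)

  no-zero-divisors : ∀ {a b} → a ≢ 0# → a * b ≡ 0# → b ≡ 0#
  no-zero-divisors {a} {b} a≢0 ab≡0 =
    let c , ac≡1 = inverse a a≢0 in begin
      b              ≡⟨ solve 1 (λ b → b := :1 :* b) refl b ⟩
      1# * b         ≡⟨ cong (_* b) ac≡1 ⟨
      a * c * b      ≡⟨ solve 3 (λ a b c → a :* c :* b := c :* (a :* b)) refl a b c ⟩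
      c * (a * b)    ≡⟨ cong (c *_) ab≡0 ⟩
      c * 0#         ≡⟨ zeroʳ c ⟩
      0#             ∎
    where open ≡-Reasoning

  *-pos : ∀ {a b} → 0# < a → 0# < b → 0# < a * b
  *-pos (0≤a , 0≢a) (0≤b , 0≢b) = *-nonneg 0≤a 0≤b ,
    λ 0≡ab → 0≢b (sym (no-zero-divisors (λ a≡0 → 0≢a (sym a≡0)) (sym 0≡ab)))

  *-monoˡ-< : ∀ {a x y} → 0# < a → x < y → a * x < a * y
  *-monoˡ-< {a} {x} {y} 0<a x<y = lin₁< (*-pos 0<a 0<y-x)
    (solve 3 (λ a x y → a :* y :+ :- (a :* x) := a :* (y :+ :- x) :+ :- :0) refl a x y)
    where
    0<y-x : 0# < y + - x
    0<y-x = lin₁< x<y (solve 2 (λ x y → y :+ :- x :+ :- :0 := y :+ :- x) refl x y)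

  *-cancelˡ-≤ : ∀ {a x y} → 0# < a → a * x ≤ a * y → x ≤ y
  *-cancelˡ-≤ {a} {x} {y} 0<a ax≤ay with ≤-or-> x y
  ... | inj₁ x≤y = x≤y
  ... | inj₂ y<x = contradiction ax≤ay (<⇒≱ (*-monoˡ-< 0<a y<x))

  abstract
    recip : ∀ {x} → 0# < x → ∃[ y ] 0# < y × x * y ≡ 1#
    recip {x} 0<x@(_ , 0≢x) with inverse x (λ x≡0 → 0≢x (sym x≡0))
    ... | y , xy≡1 with ≤-or-> y 0#
    ...   | inj₂ 0<y = y , 0<y , xy≡1
    ...   | inj₁ y≤0 = contradiction 1≤0 (<⇒≱ 0<1)
      where
      1≤0 : 1# ≤ 0#
      1≤0 = subst₂ _≤_ xy≡1 (zeroʳ x) (*-monoˡ (proj₁ 0<x) y≤0)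

  recip-cancel : ∀ {c} (0<c : 0# < c) x → c * (proj₁ (recip 0<c) * x) ≡ x
  recip-cancel {c} 0<c x = trans (sym (*-assoc c _ x))
    (trans (cong (_* x) (proj₂ (proj₂ (recip 0<c)))) (*-identityˡ x))

  |x|-lub : ∀ {x c} → x ≤ c → - x ≤ c → ∣ x ∣ ≤ c
  |x|-lub = ∨-lub

  x≤|x| : ∀ x → x ≤ ∣ x ∣
  x≤|x| x = x≤x∨y x (- x)

  -x≤|x| : ∀ x → - x ≤ ∣ x ∣
  -x≤|x| x = y≤x∨y x (- x)

  0≤|x| : ∀ x → 0# ≤ ∣ x ∣
  0≤|x| x with total 0# x
  ... | inj₁ 0≤x = ≤-trans 0≤x (x≤|x| x)
  ... | inj₂ x≤0 = ≤-trans (subst (_≤ - x) (solve 0 (:- :0 := :0) refl) (neg-mono x≤0)) (-x≤|x| x)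

  |x|≡x : ∀ {x} → 0# ≤ x → ∣ x ∣ ≡ x
  |x|≡x {x} 0≤x = ≤-antisym (|x|-lub ≤-refl (≤-trans -x≤0 0≤x)) (x≤|x| x)
    where
    -x≤0 : - x ≤ 0#
    -x≤0 = lin₁ 0≤x (solve 1 (λ x → :0 :+ :- (:- x) := x :+ :- :0) refl x)

  ⌜_⌝ : ℕ → ℝ
  ⌜ n ⌝ = n · 1#

  0≤⌜_⌝ : ∀ n → 0# ≤ ⌜ n ⌝
  0≤⌜ zero ⌝  = ≤-refl
  0≤⌜ suc n ⌝ = +-nonneg 0≤1 0≤⌜ n ⌝

  ⌜⌝-+ : ∀ m n → ⌜ m ℕ.+ n ⌝ ≡ ⌜ m ⌝ + ⌜ n ⌝
  ⌜⌝-+ zero    n = sym (+-identityˡ _)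
  ⌜⌝-+ (suc m) n = trans (cong (1# +_) (⌜⌝-+ m n)) (sym (+-assoc 1# _ _))

  ⌜⌝-mono : ∀ {m n} → m ℕ.≤ n → ⌜ m ⌝ ≤ ⌜ n ⌝
  ⌜⌝-mono {n = n} z≤n = 0≤⌜ n ⌝
  ⌜⌝-mono (s≤s m≤n)   = +-mono ≤-refl (⌜⌝-mono m≤n)

  1≤⌜1+n⌝ : ∀ n → 1# ≤ ⌜ suc n ⌝
  1≤⌜1+n⌝ n = subst (_≤ ⌜ suc n ⌝) (+-identityʳ 1#) (+-mono ≤-refl 0≤⌜ n ⌝)

  0<⌜1+n⌝ : ∀ n → 0# < ⌜ suc n ⌝
  0<⌜1+n⌝ n = <-≤-trans 0<1 (1≤⌜1+n⌝ n)

  ⌜⌝-* : ∀ m n → ⌜ m ℕ.* n ⌝ ≡ ⌜ m ⌝ * ⌜ n ⌝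
  ⌜⌝-* zero    n = sym (zeroˡ _)
  ⌜⌝-* (suc m) n = trans (⌜⌝-+ n (m ℕ.* n)) (trans (cong (⌜ n ⌝ +_) (⌜⌝-* m n))
    (solve 2 (λ x y → x :+ y :* x := (:1 :+ y) :* x) refl ⌜ n ⌝ ⌜ m ⌝))

  ⌜⌝-cancel-≤ : ∀ {m n} → ⌜ m ⌝ ≤ ⌜ n ⌝ → m ℕ.≤ n
  ⌜⌝-cancel-≤ {m} {n} p with m ℕ.≤? n
  ... | yes m≤n = m≤n
  ... | no m≰n  = contradiction
    (≤-trans (⌜⌝-mono (ℕ.≰⇒> m≰n)) p)
    (<⇒≱ (lin₁< 0<1 (solve 1 (λ x → (:1 :+ x) :+ :- x := :1 :+ :- :0) refl ⌜ n ⌝)))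

  abstract
    archimedean : ∀ x → ∃[ n ] x < ⌜ n ⌝
    archimedean x with em {P = ∃[ n ] x < ⌜ n ⌝}
    ... | yes found = found
    ... | no none   = contradiction s≤s-1 (<⇒≱ (lin₁< 0<1
        (solve 1 (λ s → s :+ :- (s :+ :- :1) := :1 :+ :- :0) refl s)))
      where
      bound : ∀ n → ⌜ n ⌝ ≤ x
      bound n with ≤-or-> ⌜ n ⌝ x
      ... | inj₁ p = p
      ... | inj₂ p = contradiction (n , p) none
      lub : ∃[ s ] IsLub _≤_ (λ y → ∃[ n ] y ≡ ⌜ n ⌝) s
      lub = complete _ (0# , 0 , refl) (x , λ { y (n , refl) → bound n })
      s : ℝ
      s = proj₁ lub
      s≤s-1 : s ≤ s + - 1#
      s≤s-1 = proj₂ (proj₂ lub) (s + - 1#) λ { y (n , refl) →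
        lin₁ (proj₁ (proj₂ lub) ⌜ suc n ⌝ (suc n , refl))
          (solve 2 (λ s y → s :+ :- :1 :+ :- y := s :+ :- (:1 :+ y)) refl s ⌜ n ⌝) }

  lub-unique : ∀ {P Q : Pred ℝ 0ℓ} {s t} → IsLub _≤_ P s → IsLub _≤_ Q t → P ≐ Q → s ≡ t
  lub-unique {s = s} {t} (ubs , lubs) (ubt , lubt) (P⊆Q , Q⊆P) =
    ≤-antisym (lubs t λ x Px → ubt x (P⊆Q Px)) (lubt s λ x Qx → ubs x (Q⊆P Qx))

  sup-isLub : ∀ (P : Pred ℝ 0ℓ) → ∃ P → (∃[ b ] ∀ x → P x → x ≤ b) → IsLub _≤_ P (sup P)
  sup-isLub P inhabited bounded with em {P = ∃ P × (∃[ b ] ∀ x → P x → x ≤ b)}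
  ... | yes (i , b) = proj₂ (complete P i b)
  ... | no ¬ib      = contradiction (inhabited , bounded) ¬ib

  ⋎-isLub : ∀ y x → IsLub _≤_ (λ r → ∃[ n ] r ≡ x n ∧ y) (⋎ y x)
  ⋎-isLub y x = sup-isLub _ (x 0 ∧ y , 0 , refl) (y , λ { r (n , refl) → x∧y≤y (x n) y })

  ⋎-upper : ∀ y x n → x n ∧ y ≤ ⋎ y x
  ⋎-upper y x n = proj₁ (⋎-isLub y x) _ (n , refl)

  ⋎-least : ∀ y x b → (∀ n → x n ∧ y ≤ b) → ⋎ y x ≤ b
  ⋎-least y x b h = proj₂ (⋎-isLub y x) b λ { _ (n , refl) → h n }

  ⋎-cong : ∀ {y y′ x x′} → y ≡ y′ → (∀ n → x n ≡ x′ n) → ⋎ y x ≡ ⋎ y′ x′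
  ⋎-cong {y} {x = x} {x′} refl x≗x′ = lub-unique (⋎-isLub y x) (⋎-isLub y x′)
    ( (λ { (n , refl) → n , cong (_∧ y) (x≗x′ n) })
    , (λ { (n , refl) → n , cong (_∧ y) (sym (x≗x′ n)) }))

  -- Natural and real powers

  open Powers (CommutativeRing.commutativeSemiring commutativeRing)
    using (^-assocʳ; ^-distrib-*)

  ^-nonneg : ∀ {x} n → 0# ≤ x → 0# ≤ x ^ n
  ^-nonneg zero    0≤x = 0≤1
  ^-nonneg (suc n) 0≤x = *-nonneg 0≤x (^-nonneg n 0≤x)

  ^-pos : ∀ {x} n → 0# < x → 0# < x ^ n
  ^-pos zero    0<x = 0<1
  ^-pos (suc n) 0<x = *-pos 0<x (^-pos n 0<x)

  ^-monoˡ : ∀ {x y} n → 0# ≤ x → x ≤ y → x ^ n ≤ y ^ n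
  ^-monoˡ zero    0≤x x≤y = ≤-refl
  ^-monoˡ (suc n) 0≤x x≤y =
    *-mono 0≤x (^-nonneg n (≤-trans 0≤x x≤y)) x≤y (^-monoˡ n 0≤x x≤y)

  1^n≡1 : ∀ n → 1# ^ n ≡ 1#
  1^n≡1 zero    = refl
  1^n≡1 (suc n) = trans (*-identityˡ _) (1^n≡1 n)

  1≤^ : ∀ {x} n → 1# ≤ x → 1# ≤ x ^ n
  1≤^ {x} n 1≤x = subst (_≤ x ^ n) (1^n≡1 n) (^-monoˡ n 0≤1 1≤x)

  ^≤1 : ∀ {x} n → 0# ≤ x → x ≤ 1# → x ^ n ≤ 1#
  ^≤1 {x} n 0≤x x≤1 = subst (x ^ n ≤_) (1^n≡1 n) (^-monoˡ n 0≤x x≤1)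

  ^-monoʳ : ∀ {x m n} → 1# ≤ x → m ℕ.≤ n → x ^ m ≤ x ^ n
  ^-monoʳ {n = n} 1≤x z≤n    = 1≤^ n 1≤x
  ^-monoʳ 1≤x (s≤s m≤n)      = *-monoˡ (≤-trans 0≤1 1≤x) (^-monoʳ 1≤x m≤n)

  ^-cancel-≤ : ∀ {x y n} → 0 ℕ.< n → 0# ≤ y → x ^ n ≤ y ^ n → x ≤ y
  ^-cancel-≤ {x} {y} {suc n} (s≤s _) 0≤y xⁿ≤yⁿ with ≤-or-> x y
  ... | inj₁ x≤y = x≤y
  ... | inj₂ y<x = contradiction xⁿ≤yⁿ (<⇒≱ (≤-<-trans
    (*-monoˡ 0≤y (^-monoˡ n 0≤y (proj₁ y<x)))
    (subst₂ _<_ (*-comm _ y) (*-comm _ x)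
      (*-monoˡ-< (^-pos n (≤-<-trans 0≤y y<x)) y<x))))

  abstract
    -- By yⁿ⁺¹ - xⁿ⁺¹ = y (yⁿ - xⁿ) + xⁿ (y - x). This takes the place of continuity in the
    -- construction of roots.
    ^-lipschitz : ∀ B → 0# ≤ B → ∀ n → ∃[ C ] 0# ≤ C × (∀ {x y} → 0# ≤ x → x ≤ y → y ≤ B →
                  y ^ n + - (x ^ n) ≤ C * (y + - x))
    ^-lipschitz B 0≤B zero = 0# , ≤-refl , λ {x} {y} _ _ _ →
      ≤-reflexive (solve 1 (λ d → :1 :+ :- :1 := :0 :* d) refl (y + - x))
    ^-lipschitz B 0≤B (suc n) with ^-lipschitz B 0≤B n
    ... | C , 0≤C , bound = B * C + B ^ n , +-nonneg (*-nonneg 0≤B 0≤C) (^-nonneg n 0≤B) ,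
      λ {x} {y} 0≤x x≤y y≤B →
        ≤-trans (≤-reflexive (solve 4 (λ x y u v → y :* v :+ :- (x :* u) := y :* (v :+ :- u) :+ u :* (y :+ :- x))
                  refl x y (x ^ n) (y ^ n)))
        (≤-trans (+-mono (*-mono (≤-trans 0≤x x≤y) (*-nonneg 0≤C (0≤-diff x≤y)) y≤B (bound 0≤x x≤y y≤B))
                         (*-monoʳ (0≤-diff x≤y) (^-monoˡ n 0≤x (≤-trans x≤y y≤B))))
          (≤-reflexive (solve 4 (λ b c d e → b :* (c :* d) :+ e :* d := (b :* c :+ e) :* d)
            refl B C (y + - x) (B ^ n))))

  ∧-pos : ∀ {x y} → 0# < x → 0# < y → 0# < x ∧ y
  ∧-pos {x} {y} 0<x 0<y with ∧-sel x y
  ... | inj₁ e = subst (0# <_) (sym e) 0<x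
  ... | inj₂ e = subst (0# <_) (sym e) 0<y

  0<-diff : ∀ {x y} → x < y → 0# < y + - x
  0<-diff {x} {y} x<y = lin₁< x<y (solve 2 (λ x y → y :+ :- x :+ :- :0 := y :+ :- x) refl x y)

  -- The root is the supremum s of the y ≥ 1 with yⁿ ≤ a; as a ≥ 1, this set contains 1 and is
  -- bounded by a. If sⁿ < a, then s can be raised within the set; if a < sⁿ, then a smaller number
  -- is already an upper bound.
  root-exists : ∀ {a n} → 1# ≤ a → 0 ℕ.< n → ∃[ z ] 0# ≤ z × z ^ n ≡ a
  root-exists {a} {suc k} 1≤a (s≤s _) = s , 0≤s , ≤-antisym sⁿ≤a a≤sⁿ
    where
    n = suc k
    below : Pred ℝ 0ℓ
    below y = 1# ≤ y × y ^ n ≤ a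
    y≤yⁿ : ∀ {y} → 1# ≤ y → y ≤ y ^ n
    y≤yⁿ {y} 1≤y = subst (_≤ y ^ n) (*-identityʳ y) (*-monoˡ (≤-trans 0≤1 1≤y) (1≤^ k 1≤y))
    lub : ∃[ s ] IsLub _≤_ below s
    lub = complete below (1# , ≤-refl , ≤-trans (≤-reflexive (1^n≡1 n)) 1≤a)
      (a , λ y (1≤y , yⁿ≤a) → ≤-trans (y≤yⁿ 1≤y) yⁿ≤a)
    s = proj₁ lub
    upper = proj₁ (proj₂ lub)
    1≤s : 1# ≤ s
    1≤s = upper 1# (≤-refl , ≤-trans (≤-reflexive (1^n≡1 n)) 1≤a)
    0≤s : 0# ≤ s
    0≤s = ≤-trans 0≤1 1≤s
    s≤s+1 : s ≤ s + 1#
    s≤s+1 = lin₁ 0≤1 (solve 1 (λ s → s :+ :1 :+ :- s := :1 :+ :- :0) refl s)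
    module Perturb {d} (0<d : 0# < d) where
      lip = ^-lipschitz (s + 1#) (≤-trans 0≤s s≤s+1) n
      C = proj₁ lip
      1/C+1 : ∃[ r ] 0# < r × (C + 1#) * r ≡ 1#
      1/C+1 = recip (<-≤-trans 0<1 (lin₁ (proj₁ (proj₂ lip))
        (solve 1 (λ c → c :+ :1 :+ :- :1 := c :+ :- :0) refl C)))
      -- The divisor is C + 1 because the Lipschitz constant C may be 0.
      r = proj₁ 1/C+1
      -- The cap at `1#` keeps s + ε and s - ε within [0, s + 1], where the Lipschitz bound holds.
      ε = (d * r) ∧ 1#
      0<ε : 0# < ε
      0<ε = ∧-pos (*-pos 0<d (proj₁ (proj₂ 1/C+1))) 0<1
      ε≤1 : ε ≤ 1#
      ε≤1 = x∧y≤y (d * r) 1#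
      Cε≤d : C * ε ≤ d
      Cε≤d = ≤-trans (lin₁ (proj₁ 0<ε) (solve 2 (λ c e → (c :+ :1) :* e :+ :- (c :* e) := e :+ :- :0) refl C ε))
        (≤-trans (*-monoˡ (+-nonneg (proj₁ (proj₂ lip)) 0≤1) (x∧y≤x (d * r) 1#))
        (≤-reflexive (trans (solve 3 (λ c d r → (c :+ :1) :* (d :* r) := d :* ((c :+ :1) :* r)) refl C d r)
          (trans (cong (d *_) (proj₂ (proj₂ 1/C+1))) (*-identityʳ d)))))
      change : ∀ {x y} → 0# ≤ x → x ≤ y → y ≤ s + 1# → y + - x ≡ ε → y ^ n + - (x ^ n) ≤ d
      change 0≤x x≤y y≤B e = ≤-trans (proj₂ (proj₂ lip) 0≤x x≤y y≤B) (≤-trans (≤-reflexive (cong (C *_) e)) Cε≤d)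
    module Raise (sⁿ<a : s ^ n < a) where
      open Perturb (0<-diff sⁿ<a) public
      s≤s+ε : s ≤ s + ε
      s≤s+ε = lin₁ (proj₁ 0<ε) (solve 2 (λ s e → s :+ e :+ :- s := e :+ :- :0) refl s ε)
      [s+ε]ⁿ≤a : (s + ε) ^ n ≤ a
      [s+ε]ⁿ≤a = lin₁ (change 0≤s s≤s+ε (+-mono ≤-refl ε≤1) (solve 2 (λ s e → s :+ e :+ :- s := e) refl s ε))
        (solve 3 (λ a u v → a :+ :- u := a :+ :- v :+ :- (u :+ :- v)) refl a ((s + ε) ^ n) (s ^ n))
    a≤sⁿ : a ≤ s ^ n
    a≤sⁿ = ≮⇒≥ λ sⁿ<a → let open Raise sⁿ<a in contradiction (upper (s + ε) (≤-trans 1≤s s≤s+ε , [s+ε]ⁿ≤a)) (<⇒≱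
        (lin₁< 0<ε (solve 2 (λ s e → s :+ e :+ :- s := e :+ :- :0) refl s ε)))
    module Lower (a<sⁿ : a < s ^ n) where
      open Perturb (0<-diff a<sⁿ) public
      0≤s-ε : 0# ≤ s + - ε
      0≤s-ε = 0≤-diff (≤-trans ε≤1 1≤s)
      a≤[s-ε]ⁿ : a ≤ (s + - ε) ^ n
      a≤[s-ε]ⁿ = lin₁ (change 0≤s-ε (lin₁ (proj₁ 0<ε) (solve 2 (λ s e → s :+ :- (s :+ :- e) := e :+ :- :0) refl s ε))
          s≤s+1 (solve 2 (λ s e → s :+ :- (s :+ :- e) := e) refl s ε))
        (solve 3 (λ a u v → u :+ :- a := v :+ :- a :+ :- (v :+ :- u)) refl a ((s + - ε) ^ n) (s ^ n))
      s≤s-ε : s ≤ s + - ε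
      s≤s-ε = proj₂ (proj₂ lub) (s + - ε) λ y (1≤y , yⁿ≤a) →
        ^-cancel-≤ {n = n} (s≤s z≤n) 0≤s-ε (≤-trans yⁿ≤a a≤[s-ε]ⁿ)
    sⁿ≤a : s ^ n ≤ a
    sⁿ≤a = ≮⇒≥ λ a<sⁿ → let open Lower a<sⁿ in contradiction s≤s-ε (<⇒≱
        (lin₁< 0<ε (solve 2 (λ s e → s :+ :- (s :+ :- e) := e :+ :- :0) refl s ε)))

  abstract
    -- The opaque form for later use, which keeps the construction from being unfolded.
    root : ∀ {a n} → 1# ≤ a → 0 ℕ.< n → ∃[ z ] 0# ≤ z × z ^ n ≡ a
    root = root-exists

  -- The hypothesis `0# ≤ b` covers the junk value of `sup`, so P may be empty.
  sup-≤ : ∀ {P : Pred ℝ 0ℓ} {b} → 0# ≤ b → (∀ x → P x → x ≤ b) → sup P ≤ b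
  sup-≤ {P} {b} 0≤b ub with em {P = ∃ P × (∃[ b ] ∀ x → P x → x ≤ b)}
  ... | yes (i , bdd) = proj₂ (proj₂ (complete P i bdd)) b ub
  ... | no _          = 0≤b

  -- Real powers with exponent p ≥ 1

  module RealPower (p : ℝ) (1≤p : 1# ≤ p) where

    RationalPower≤ : ℝ → Pred ℝ 0ℓ
    RationalPower≤ x y = 0# ≤ y × ∃[ m ] ∃[ n ] 0 ℕ.< n × m · 1# ≤ (n · 1#) * p × y ^ n ≡ x ^ m

    -- A natural number above p. A rational exponent m / n ≤ p has m ≤ n N, so xᴺ bounds the
    -- rational powers of x ≥ 1, and 2ᴺ serves as the doubling constant.
    N : ℕ
    N = proj₁ (archimedean p)

    m≤n*N : ∀ {m n} → ⌜ m ⌝ ≤ ⌜ n ⌝ * p → m ℕ.≤ n ℕ.* N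
    m≤n*N {m} {n} m≤np = ⌜⌝-cancel-≤ (≤-trans m≤np (≤-trans
      (*-monoˡ 0≤⌜ n ⌝ (proj₁ (proj₂ (archimedean p)))) (≤-reflexive (sym (⌜⌝-* n N)))))

    ^-*-swap : ∀ x m n → x ^ (m ℕ.* n) ≡ (x ^ n) ^ m
    ^-*-swap x m n = trans (cong (x ^_) (ℕ.*-comm m n)) (sym (^-assocʳ x n m))

    self∈ : ∀ {x} → 1# ≤ x → RationalPower≤ x x
    self∈ 1≤x = ≤-trans 0≤1 1≤x , 1 , 1 , s≤s z≤n ,
      subst (_≤ ⌜ 1 ⌝ * p) (*-identityʳ _) (*-monoˡ 0≤⌜ 1 ⌝ 1≤p) , refl

    rationalPower≤-bounded : ∀ {x} → 1# ≤ x → ∀ y → RationalPower≤ x y → y ≤ x ^ N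
    rationalPower≤-bounded {x} 1≤x y (_ , m , n , 0<n , m≤np , yⁿ≡xᵐ) =
      ^-cancel-≤ 0<n (^-nonneg N (≤-trans 0≤1 1≤x)) (≤-trans (≤-reflexive yⁿ≡xᵐ)
        (≤-trans (^-monoʳ 1≤x (m≤n*N {m} {n} m≤np)) (≤-reflexive (^-*-swap x n N))))

    -- Hides the two branches of `^ʳ`. They overlap at x = 1, where `total` may choose the supremum
    -- over exponents q ≥ p; there both sets have 1 as their greatest element.
    ^ʳ-isLub : ∀ {x} → 1# ≤ x → IsLub _≤_ (RationalPower≤ x) (x ^ʳ p)
    ^ʳ-isLub {x} 1≤x with total 1# x
    ... | inj₁ _ = sup-isLub _ (x , self∈ 1≤x) (x ^ N , rationalPower≤-bounded 1≤x)
    ... | inj₂ x≤1 with ≤-antisym x≤1 1≤x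
    ...   | refl = (λ y (0≤y , m , n , 0<n , _ , yⁿ≡1ᵐ) → ≤-trans (y≤1 y m n 0<n yⁿ≡1ᵐ) (1≤sup)) ,
                   λ b ub → ≤-trans sup≤1 (ub 1# (self∈ ≤-refl))
      where
      y≤1 : ∀ y m n → 0 ℕ.< n → y ^ n ≡ 1# ^ m → y ≤ 1#
      y≤1 y m n 0<n e = ^-cancel-≤ 0<n 0≤1 (≤-reflexive (trans e (trans (1^n≡1 m) (sym (1^n≡1 n)))))
      RationalPower≥ : Pred ℝ 0ℓ
      RationalPower≥ y = 0# ≤ y × ∃[ m ] ∃[ n ] 0 ℕ.< n × (n · 1#) * p ≤ m · 1# × y ^ n ≡ 1# ^ m
      ub : ∀ y → RationalPower≥ y → y ≤ 1#
      ub y (_ , m , n , 0<n , _ , e) = y≤1 y m n 0<n e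
      1∈ : RationalPower≥ 1#
      1∈ = 0≤1 , N , 1 , s≤s z≤n , ≤-trans (*-monoˡ 0≤⌜ 1 ⌝ (proj₁ (proj₂ (archimedean p))))
             (≤-reflexive (trans (sym (⌜⌝-* 1 N)) (cong ⌜_⌝ (ℕ.*-identityˡ N)))) , trans (1^n≡1 1) (sym (1^n≡1 N))
      1≤sup : 1# ≤ sup RationalPower≥
      1≤sup = proj₁ (sup-isLub RationalPower≥ (1# , 1∈) (1# , ub)) 1# 1∈
      sup≤1 : sup RationalPower≥ ≤ 1#
      sup≤1 = sup-≤ 0≤1 ub

    x≤x^ʳp : ∀ {x} → 1# ≤ x → x ≤ x ^ʳ p
    x≤x^ʳp 1≤x = proj₁ (^ʳ-isLub 1≤x) _ (self∈ 1≤x)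

    1≤x^ʳp : ∀ {x} → 1# ≤ x → 1# ≤ x ^ʳ p
    1≤x^ʳp 1≤x = ≤-trans 1≤x (x≤x^ʳp 1≤x)

    -- In either branch every competitor y satisfies yⁿ = xᵐ ≤ 1.
    x^ʳp≤1 : ∀ {x} → 0# ≤ x → x ≤ 1# → x ^ʳ p ≤ 1#
    x^ʳp≤1 {x} 0≤x x≤1 with total 1# x
    ... | inj₁ _ = sup-≤ 0≤1 λ y (_ , m , n , 0<n , _ , e) → ^-cancel-≤ 0<n 0≤1
      (≤-trans (≤-reflexive e) (≤-trans (^≤1 m 0≤x x≤1) (≤-reflexive (sym (1^n≡1 n)))))
    ... | inj₂ _ = sup-≤ 0≤1 λ y (_ , m , n , 0<n , _ , e) → ^-cancel-≤ 0<n 0≤1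
      (≤-trans (≤-reflexive e) (≤-trans (^≤1 m 0≤x x≤1) (≤-reflexive (sym (1^n≡1 n)))))

    -- A rational power of u is compared with the power of v of the same exponent, which exists by
    -- `root`.
    ^ʳ-mono : ∀ {u v} → 1# ≤ u → u ≤ v → u ^ʳ p ≤ v ^ʳ p
    ^ʳ-mono {u} {v} 1≤u u≤v = proj₂ (^ʳ-isLub 1≤u) _ λ y (_ , m , n , 0<n , m≤np , yⁿ≡uᵐ) →
      let 1≤v = ≤-trans 1≤u u≤v
          z , 0≤z , zⁿ≡vᵐ = root (1≤^ m 1≤v) 0<n
      in ≤-trans (^-cancel-≤ 0<n 0≤z (≤-trans (≤-reflexive yⁿ≡uᵐ)
           (≤-trans (^-monoˡ m (≤-trans 0≤1 1≤u) u≤v) (≤-reflexive (sym zⁿ≡vᵐ)))))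
         (proj₁ (^ʳ-isLub 1≤v) z (0≤z , m , n , 0<n , m≤np , zⁿ≡vᵐ))

    1≤2u : ∀ {u} → 1# ≤ u → 1# ≤ 2# * u
    1≤2u {u} 1≤u = ≤-trans 1≤2 (subst (_≤ 2# * u) (*-identityʳ 2#) (*-monoˡ (proj₁ 0<2) 1≤u))

    -- For each rational exponent q = m / n ≤ p, (2u)^q = 2^q u^q and 2^q ≤ 2ᴺ; both facts are
    -- checked on n-th powers.
    ^ʳ-double-≤ : ∀ {u} → 1# ≤ u → (2# * u) ^ʳ p ≤ 2# ^ N * u ^ʳ p
    ^ʳ-double-≤ {u} 1≤u = proj₂ (^ʳ-isLub (1≤2u 1≤u)) _ λ y (_ , m , n , 0<n , m≤np , yⁿ≡[2u]ᵐ) →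
      let z , 0≤z , zⁿ≡uᵐ = root (1≤^ m 1≤u) 0<n
          open ≤-Reasoning
          yⁿ≤ = begin
            y ^ n                     ≡⟨ yⁿ≡[2u]ᵐ ⟩
            (2# * u) ^ m              ≡⟨ ^-distrib-* 2# u m ⟩
            2# ^ m * u ^ m            ≡⟨ cong (2# ^ m *_) zⁿ≡uᵐ ⟨
            2# ^ m * z ^ n            ≤⟨ *-monoʳ (^-nonneg n 0≤z) (^-monoʳ 1≤2 (m≤n*N {m} {n} m≤np)) ⟩
            2# ^ (n ℕ.* N) * z ^ n    ≡⟨ cong (_* z ^ n) (^-*-swap 2# n N) ⟩
            (2# ^ N) ^ n * z ^ n      ≡⟨ ^-distrib-* (2# ^ N) z n ⟨
            (2# ^ N * z) ^ n          ∎
      in ≤-trans (^-cancel-≤ 0<n (*-nonneg (^-nonneg N (proj₁ 0<2)) 0≤z) yⁿ≤)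
           (*-monoˡ (^-nonneg N (proj₁ 0<2)) (proj₁ (^ʳ-isLub 1≤u) z (0≤z , m , n , 0<n , m≤np , zⁿ≡uᵐ)))

    -- It suffices that half of (2u)ᵖ bounds every u^q with q ≤ p. If q ≥ 1, then 2 u^q ≤ 2^q u^q =
    -- (2u)^q. If q ≤ 1, then u^q ≤ u, and 2u ≤ (2u)ᵖ because p ≥ 1.
    ^ʳ-double-≥ : ∀ {u} → 1# ≤ u → 2# * u ^ʳ p ≤ (2# * u) ^ʳ p
    ^ʳ-double-≥ {u} 1≤u = subst (2# * u ^ʳ p ≤_) (recip-cancel 0<2 W)
        (*-monoˡ (proj₁ 0<2) (proj₂ (^ʳ-isLub 1≤u) (½ * W) λ z z∈ →
          *-cancelˡ-≤ 0<2 (subst (2# * z ≤_) (sym (recip-cancel 0<2 W)) (double z z∈))))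
      where
      W = (2# * u) ^ʳ p
      ½ = proj₁ (recip 0<2)
      0≤2 = proj₁ 0<2
      0≤u = ≤-trans 0≤1 1≤u
      double : ∀ z → RationalPower≤ u z → 2# * z ≤ W
      double z (0≤z , m , n , 0<n , m≤np , zⁿ≡uᵐ) with ℕ.≤-total n m
      ... | inj₁ n≤m =
        let y , 0≤y , yⁿ≡ = root (1≤^ m (1≤2u 1≤u)) 0<n
            open ≤-Reasoning
            le = begin
              (2# * z) ^ n    ≡⟨ ^-distrib-* 2# z n ⟩
              2# ^ n * z ^ n  ≡⟨ cong (2# ^ n *_) zⁿ≡uᵐ ⟩
              2# ^ n * u ^ m  ≤⟨ *-monoʳ (^-nonneg m 0≤u) (^-monoʳ 1≤2 n≤m) ⟩
              2# ^ m * u ^ m  ≡⟨ ^-distrib-* 2# u m ⟨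
              (2# * u) ^ m    ≡⟨ yⁿ≡ ⟨
              y ^ n           ∎
        in ≤-trans (^-cancel-≤ 0<n 0≤y le)
             (proj₁ (^ʳ-isLub (1≤2u 1≤u)) y (0≤y , m , n , 0<n , m≤np , yⁿ≡))
      ... | inj₂ m≤n = ≤-trans (*-monoˡ 0≤2 (^-cancel-≤ 0<n 0≤u
            (≤-trans (≤-reflexive zⁿ≡uᵐ) (^-monoʳ 1≤u m≤n))))
          (x≤x^ʳp (1≤2u 1≤u))

    ^ʳ-double^-≥ : ∀ {u} k → 1# ≤ u → 2# ^ k * u ^ʳ p ≤ (2# ^ k * u) ^ʳ p
    ^ʳ-double^-≥ {u} zero 1≤u = ≤-reflexive (trans (*-identityˡ _) (cong (_^ʳ p) (sym (*-identityˡ u))))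
    ^ʳ-double^-≥ {u} (suc k) 1≤u = begin
      2# * 2# ^ k * u ^ʳ p        ≡⟨ *-assoc 2# _ _ ⟩
      2# * (2# ^ k * u ^ʳ p)      ≤⟨ *-monoˡ (proj₁ 0<2) (^ʳ-double^-≥ k 1≤u) ⟩
      2# * (2# ^ k * u) ^ʳ p      ≤⟨ ^ʳ-double-≥ 1≤2ᵏu ⟩
      (2# * (2# ^ k * u)) ^ʳ p    ≡⟨ cong (_^ʳ p) (*-assoc 2# _ _) ⟨
      (2# * 2# ^ k * u) ^ʳ p      ∎
      where
      open ≤-Reasoning
      1≤2ᵏu : 1# ≤ 2# ^ k * u
      1≤2ᵏu = subst (_≤ 2# ^ k * u) (*-identityˡ 1#)
        (*-mono 0≤1 (≤-trans 0≤1 1≤u) (1≤^ k 1≤2) 1≤u)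

  -- Rational numbers and measurable functions

  -- Cantor's walk along the antidiagonals; from the end (a , 0) it jumps to the start (0 , a + 1)
  -- of the next one.
  next : ℕ × ℕ → ℕ × ℕ
  next (a , zero)  = zero , suc a
  next (a , suc b) = suc a , b

  unpair : ℕ → ℕ × ℕ
  unpair zero    = zero , zero
  unpair (suc n) = next (unpair n)

  unpair-surjective : ∀ a b → ∃[ n ] unpair n ≡ (a , b)
  unpair-surjective a b = on-diagonal (a ℕ.+ b) a b refl
    where
    -- The walk is traced backwards, so the pair (s , a) decreases lexicographically.
    on-diagonal : ∀ s a b → a ℕ.+ b ≡ s → ∃[ n ] unpair n ≡ (a , b)
    on-diagonal s (suc a) b e with on-diagonal s a (suc b) (trans (ℕ.+-suc a b) e)
    ... | n , e′ = suc n , cong next e′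
    on-diagonal zero zero zero e = 0 , refl
    on-diagonal (suc s) zero (suc b) e with on-diagonal s b zero (trans (ℕ.+-identityʳ b) (ℕ.suc-injective e))
    ... | n , e′ = suc n , cong next e′

  floor : ∀ {z} → 0# ≤ z → ∃[ a ] ⌜ a ⌝ ≤ z × z < ⌜ suc a ⌝
  floor {z} 0≤z = let n , z<n = archimedean z in search n z<n
    where
    search : ∀ n → z < ⌜ n ⌝ → ∃[ a ] ⌜ a ⌝ ≤ z × z < ⌜ suc a ⌝
    search zero    z<0 = contradiction 0≤z (<⇒≱ z<0)
    search (suc n) z<n with ≤-or-> ⌜ n ⌝ z
    ... | inj₁ n≤z = n , n≤z , z<n
    ... | inj₂ z<n = search n z<n

  *-cancelˡ-< : ∀ {a x y} → 0# < a → a * x < a * y → x < y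
  *-cancelˡ-< 0<a ax<ay = ≰⇒> λ y≤x → <⇒≱ ax<ay (*-monoˡ (proj₁ 0<a) y≤x)

  fraction : ℕ → ℕ → ℕ → ℝ
  fraction a b c = proj₁ (recip (0<⌜1+n⌝ c)) * (⌜ a ⌝ + - ⌜ b ⌝)

  enumeration : ℕ → ℝ
  enumeration n = fraction (proj₁ (unpair n)) (proj₁ (unpair k)) (proj₂ (unpair k))
    where
    k : ℕ
    k = proj₂ (unpair n)

  enumeration-surjective : ∀ a b c → ∃[ n ] enumeration n ≡ fraction a b c
  enumeration-surjective a b c with unpair-surjective b c
  ... | k , k≡ with unpair-surjective a k
  ...   | n , n≡ = n , trans (cong (λ (a , k) → fraction a (proj₁ (unpair k)) (proj₂ (unpair k))) n≡)
                             (cong (λ (b , c) → fraction a b c) k≡)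

  -- With M = c + 1 so large that M x and M y are more than 1 apart, a - b is the integer part of M
  -- x, and the next integer lies strictly between M x and M y. Adding b makes M x nonnegative, so
  -- that `floor` applies.
  fraction-between : ∀ {x y} a b c → 1# < ⌜ suc c ⌝ * (y + - x) → ⌜ a ⌝ ≤ ⌜ suc c ⌝ * x + ⌜ b ⌝ →
    ⌜ suc c ⌝ * x + ⌜ b ⌝ < ⌜ suc a ⌝ → x < fraction (suc a) b c × fraction (suc a) b c < y
  fraction-between {x} {y} a b c 1<M[y-x] a≤Mx+b Mx+b<1+a =
      *-cancelˡ-< 0<M (subst (M * x <_) (sym Mq≡)
        (lin₁< Mx+b<1+a (solve 3 (λ X b a → a :+ :- b :+ :- X := a :+ :- (X :+ b)) refl (M * x) ⌜ b ⌝ ⌜ suc a ⌝)))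
    , *-cancelˡ-< 0<M (subst (_< M * y) (sym Mq≡)
        (lin₂< 1<M[y-x] a≤Mx+b (solve 5 (λ M x y b a → M :* y :+ :- (:1 :+ a :+ :- b) :=
             (M :* (y :+ :- x) :+ :- :1) :+ (M :* x :+ b :+ :- a)) refl M x y ⌜ b ⌝ ⌜ a ⌝)))
    where
    M : ℝ
    M = ⌜ suc c ⌝
    0<M : 0# < M
    0<M = 0<⌜1+n⌝ c
    Mq≡ : M * fraction (suc a) b c ≡ ⌜ suc a ⌝ + - ⌜ b ⌝
    Mq≡ = recip-cancel 0<M (⌜ suc a ⌝ + - ⌜ b ⌝)

  large-multiple : ∀ {d} → 0# < d → ∃[ c ] 1# < ⌜ suc c ⌝ * d
  large-multiple {d} 0<d with recip 0<d
  ... | r , _ , dr≡1 with archimedean r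
  ...   | c , r<c = c , subst₂ _<_ dr≡1 (*-comm d _)
                          (*-monoˡ-< 0<d (<-≤-trans r<c (⌜⌝-mono (ℕ.n≤1+n c))))

  enumeration-dense : ∀ {x y} → x < y → ∃[ n ] x < enumeration n × enumeration n < y
  enumeration-dense {x} {y} x<y =
    case large-multiple (0<-diff x<y) of λ (c , 1<M[y-x]) →
    case archimedean (- (⌜ suc c ⌝ * x)) of λ (b , -Mx<b) →
    case floor (0≤Mx+b c b (proj₁ -Mx<b)) of λ (a , a≤ , <1+a) →
    case enumeration-surjective (suc a) b c of λ (n , n≡) →
    case fraction-between {x} {y} a b c 1<M[y-x] a≤ <1+a of λ (x<q , q<y) →
    n , subst (x <_) (sym n≡) x<q , subst (_< y) (sym n≡) q<y
    where
    0≤Mx+b : ∀ c b → - (⌜ suc c ⌝ * x) ≤ ⌜ b ⌝ → 0# ≤ ⌜ suc c ⌝ * x + ⌜ b ⌝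
    0≤Mx+b c b le = lin₁ le (solve 2 (λ X b → X :+ b :+ :- :0 := b :+ :- (:- X)) refl (⌜ suc c ⌝ * x) ⌜ b ⌝)

  -- Opaque, since unfolding the enumeration is expensive.
  abstract
    rational : ℕ → ℝ
    rational = enumeration

    rational-dense : ∀ {x y} → x < y → ∃[ n ] x < rational n × rational n < y
    rational-dense = enumeration-dense

  <-∧ : ∀ {q x y} → q < x → q < y → q < x ∧ y
  <-∧ {q} {x} {y} q<x q<y = [ (λ e → subst (q <_) (sym e) q<x) , (λ e → subst (q <_) (sym e) q<y) ]′ (∧-sel x y)

  x∨y< : ∀ {q x y} → x < q → y < q → x ∨ y < q
  x∨y< {q} {x} {y} x<q y<q = [ (λ e → subst (_< q) (sym e) x<q) , (λ e → subst (_< q) (sym e) y<q) ]′ (∨-sel x y)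

  upper-ray-open : ∀ q → Open (q <_)
  upper-ray-open q x q<x = x + - q , 0<-diff q<x , λ y |y-x|<x-q →
    lin₁< (≤-<-trans (-x≤|x| (y + - x)) |y-x|<x-q)
      (solve 3 (λ x y q → y :+ :- q := x :+ :- q :+ :- (:- (y :+ :- x))) refl x y q)

  lower-ray-open : ∀ q → Open (_< q)
  lower-ray-open q x x<q = q + - x , 0<-diff x<q , λ y |y-x|<q-x →
    lin₁< (≤-<-trans (x≤|x| (y + - x)) |y-x|<q-x)
      (solve 3 (λ x y q → q :+ :- y := q :+ :- x :+ :- (y :+ :- x)) refl x y q)

  -- Closure properties of measurable sets and functions

  module SigmaAlgebra {Ω : Set} {F : Pred (Pred Ω 0ℓ) (lsuc 0ℓ)} (isσAlgebra : IsσAlgebra F) where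
    open IsσAlgebra isσAlgebra public

    F-∪ : ∀ {A B} → F A → F B → F (A ∪ B)
    F-∪ {A} {B} FA FB = F-respects
      ( (λ { (zero , Aω) → inj₁ Aω ; (suc _ , Bω) → inj₂ Bω })
      , (λ { (inj₁ Aω) → 0 , Aω ; (inj₂ Bω) → 1 , Bω }))
      (F-union family measurable)
      where
      family : ℕ → Pred Ω 0ℓ
      family zero    = A
      family (suc _) = B
      measurable : ∀ n → F (family n)
      measurable zero    = FA
      measurable (suc _) = FB

    F-∩ : ∀ {A B} → F A → F B → F (A ∩ B)
    F-∩ {A} {B} FA FB = F-respects {∁ (∁ A ∪ ∁ B)} {A ∩ B} (to , from)
        (F-complement (F-∪ {∁ A} {∁ B} (F-complement FA) (F-complement FB)))
      where
      to : ∁ (∁ A ∪ ∁ B) ⊆ A ∩ B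
      to {ω} ¬¬ with em {P = A ω} | em {P = B ω}
      ... | yes Aω | yes Bω = Aω , Bω
      ... | no ¬Aω | _      = contradiction (inj₁ ¬Aω) ¬¬
      ... | _      | no ¬Bω = contradiction (inj₂ ¬Bω) ¬¬
      from : A ∩ B ⊆ ∁ (∁ A ∪ ∁ B)
      from (Aω , _) (inj₁ ¬Aω) = ¬Aω Aω
      from (_ , Bω) (inj₂ ¬Bω) = ¬Bω Bω

    F-∅ : F ∅
    F-∅ = F-respects ((λ ¬⊤ → ¬⊤ tt) , λ ()) (F-complement F-whole)

    -- By excluded middle such a set is everything or empty. Intersecting with it selects, inside a
    -- union over all indices, those that satisfy a condition.
    F-const : ∀ P → F (λ _ → P)
    F-const P with em {P = P}
    ... | yes p = F-respects ((λ _ → p) , (λ _ → tt)) F-whole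
    ... | no ¬p = F-respects ((λ ()) , ¬p) F-∅

    BorelMeasurable : (Ω → ℝ) → Set₁
    BorelMeasurable f = ∀ B → Borel B → F (f ⊢ B)

    measurable-upper-ray : ∀ {f} → BorelMeasurable f → ∀ q → F (λ ω → q < f ω)
    measurable-upper-ray mf q = mf (q <_) (generator (upper-ray-open q))

    measurable-lower-ray : ∀ {f} → BorelMeasurable f → ∀ q → F (λ ω → f ω < q)
    measurable-lower-ray mf q = mf (_< q) (generator (lower-ray-open q))

    -- An open set is the union of the open intervals with rational end points contained in it.
    upper-rays⇒measurable : ∀ {f} → (∀ q → F (λ ω → q < f ω)) → BorelMeasurable f
    upper-rays⇒measurable {f} above = go
      where
      Above Below : ℝ → Pred Ω 0ℓ
      Above q ω = q < f ω
      Below q ω = f ω < q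
      Approx : ℝ → ℕ → Pred Ω 0ℓ
      Approx q n = ∁ (Above (rational n)) ∩ λ _ → rational n < q
      -- {f < q} is the union of the sets {f ≤ r} over the rationals r < q, and these are
      -- complements of upper rays.
      below : ∀ q → F (Below q)
      below q = F-respects {⋃ ℕ (Approx q)} {Below q} (to , from)
          (F-union (Approx q) λ n → F-∩ {∁ (Above (rational n))} {λ _ → rational n < q}
            (F-complement (above (rational n))) (F-const (rational n < q)))
        where
        to : ⋃ ℕ (Approx q) ⊆ Below q
        to (n , r≮f , r<q) = ≤-<-trans (≮⇒≥ r≮f) r<q
        from : Below q ⊆ ⋃ ℕ (Approx q)
        from f<q = case rational-dense f<q of λ (n , f<r , r<q) → n , (λ r<f → <⇒≱ r<f (proj₁ f<r)) , r<q
      module _ (V : Pred ℝ 0ℓ) (V-open : Open V) where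
        Inside : ℕ → ℕ → Set
        Inside m n = ∀ y → rational m < y → y < rational n → V y
        Interval : ℕ → ℕ → Pred Ω 0ℓ
        Interval m n = Above (rational m) ∩ (Below (rational n) ∩ λ _ → Inside m n)
        to : ⋃ ℕ (λ m → ⋃ ℕ (Interval m)) ⊆ (f ⊢ V)
        to {ω} (m , n , m<f , f<n , inside) = inside (f ω) m<f f<n
        from : (f ⊢ V) ⊆ ⋃ ℕ (λ m → ⋃ ℕ (Interval m))
        from {ω} Vfω =
          case V-open (f ω) Vfω of λ (ε , 0<ε , ball) →
          case rational-dense (f-ε<f ε 0<ε) of λ (m , f-ε<m , m<f) →
          case rational-dense (f<f+ε ε 0<ε) of λ (n , f<n , n<f+ε) →
          m , n , m<f , f<n , λ y m<y y<n → ball y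
            (near ε m n y (proj₁ f-ε<m) (proj₁ n<f+ε) m<y y<n)
          where
          f-ε<f : ∀ ε → 0# < ε → f ω + - ε < f ω
          f-ε<f ε 0<ε = lin₁< 0<ε (solve 2 (λ f e → f :+ :- (f :+ :- e) := e :+ :- :0) refl (f ω) ε)
          f<f+ε : ∀ ε → 0# < ε → f ω < f ω + ε
          f<f+ε ε 0<ε = lin₁< 0<ε (solve 2 (λ f e → f :+ e :+ :- f := e :+ :- :0) refl (f ω) ε)
          near : ∀ ε m n y → f ω + - ε ≤ rational m → rational n ≤ f ω + ε →
                 rational m < y → y < rational n → ∣ y + - f ω ∣ < ε
          near ε m n y f-ε≤m n≤f+ε m<y y<n = x∨y<
            (lin₂< y<n n≤f+ε (solve 4 (λ f e y n → e :+ :- (y :+ :- f) := n :+ :- y :+ (f :+ e :+ :- n))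
              refl (f ω) ε y (rational n)))
            (lin₂< m<y f-ε≤m (solve 4 (λ f e y m → e :+ :- (:- (y :+ :- f)) := y :+ :- m :+ (m :+ :- (f :+ :- e)))
              refl (f ω) ε y (rational m)))
        open-preimage : F (f ⊢ V)
        open-preimage = F-respects {⋃ ℕ (λ m → ⋃ ℕ (Interval m))} {f ⊢ V} (to , from)
          (F-union (λ m → ⋃ ℕ (Interval m)) λ m → F-union (Interval m) λ n →
            F-∩ {Above (rational m)} (above (rational m))
              (F-∩ {Below (rational n)} (below (rational n)) (F-const (Inside m n))))
      go : BorelMeasurable f
      go B (generator V-open)                         = open-preimage B V-open
      go B (respects {A} (A⊆B , B⊆A) A-borel)         = F-respects {f ⊢ A} {f ⊢ B} (A⊆B , B⊆A) (go A A-borel)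
      go .U whole                                     = F-whole
      go ._ (complement {A} A-borel)                  = F-complement {f ⊢ A} (go A A-borel)
      go ._ (union A A-borel)                         = F-union (λ n → f ⊢ A n) λ n → go (A n) (A-borel n)

    measurable-const : ∀ c → BorelMeasurable (λ _ → c)
    measurable-const c = upper-rays⇒measurable λ q → F-const (q < c)

    -- q < f + g holds exactly if some rational lies strictly between q - g and f.
    measurable-+ : ∀ {f g} → BorelMeasurable f → BorelMeasurable g → BorelMeasurable (λ ω → f ω + g ω)
    measurable-+ {f} {g} mf mg = upper-rays⇒measurable λ q →
        F-respects {⋃ ℕ (Split q)} {λ ω → q < f ω + g ω} (to q , from q)
          (F-union (Split q) λ n → F-∩ {λ ω → rational n < f ω} {λ ω → q + - rational n < g ω}
            (measurable-upper-ray mf (rational n)) (measurable-upper-ray mg (q + - rational n)))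
      where
      Split : ℝ → ℕ → Pred Ω 0ℓ
      Split q n ω = rational n < f ω × q + - rational n < g ω
      to : ∀ q → ⋃ ℕ (Split q) ⊆ (λ ω → q < f ω + g ω)
      to q {ω} (n , r<f , q-r<g) = lin₂< r<f (proj₁ q-r<g)
        (solve 4 (λ f g q r → f :+ g :+ :- q := f :+ :- r :+ (g :+ :- (q :+ :- r))) refl (f ω) (g ω) q (rational n))
      from : ∀ q → (λ ω → q < f ω + g ω) ⊆ ⋃ ℕ (Split q)
      from q {ω} q<f+g = case rational-dense q-g<f of λ (n , q-g<r , r<f) → n , r<f , swap n q-g<r
        where
        q-g<f : q + - g ω < f ω
        q-g<f = lin₁< q<f+g (solve 3 (λ f g q → f :+ :- (q :+ :- g) := f :+ g :+ :- q) refl (f ω) (g ω) q)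
        swap : ∀ n → q + - g ω < rational n → q + - rational n < g ω
        swap n lt = lin₁< lt (solve 3 (λ g q r → g :+ :- (q :+ :- r) := r :+ :- (q :+ :- g)) refl (g ω) q (rational n))

    measurable-∨ : ∀ {f g} → BorelMeasurable f → BorelMeasurable g → BorelMeasurable (λ ω → f ω ∨ g ω)
    measurable-∨ {f} {g} mf mg = upper-rays⇒measurable λ q →
        F-respects {(λ ω → q < f ω) ∪ (λ ω → q < g ω)} {λ ω → q < f ω ∨ g ω} (to q , from q)
          (F-∪ {λ ω → q < f ω} {λ ω → q < g ω} (measurable-upper-ray mf q) (measurable-upper-ray mg q))
      where
      to : ∀ q → (λ ω → q < f ω) ∪ (λ ω → q < g ω) ⊆ (λ ω → q < f ω ∨ g ω)
      to q {ω} (inj₁ q<f) = <-≤-trans q<f (x≤x∨y (f ω) (g ω))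
      to q {ω} (inj₂ q<g) = <-≤-trans q<g (y≤x∨y (f ω) (g ω))
      from : ∀ q → (λ ω → q < f ω ∨ g ω) ⊆ (λ ω → q < f ω) ∪ (λ ω → q < g ω)
      from q {ω} q<f∨g = [ (λ e → inj₁ (subst (q <_) e q<f∨g)) , (λ e → inj₂ (subst (q <_) e q<f∨g)) ]′ (∨-sel (f ω) (g ω))

    measurable-neg : ∀ {f} → BorelMeasurable f → BorelMeasurable (λ ω → - f ω)
    measurable-neg {f} mf = upper-rays⇒measurable λ q →
      F-respects {λ ω → f ω < - q} {λ ω → q < - f ω} (to q , from q) (measurable-lower-ray mf (- q))
      where
      to : ∀ q → (λ ω → f ω < - q) ⊆ (λ ω → q < - f ω)
      to q {ω} f<-q = subst (_< - f ω) (neg-involutive q) (neg-mono-< f<-q)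
      from : ∀ q → (λ ω → q < - f ω) ⊆ (λ ω → f ω < - q)
      from q {ω} q<-f = subst (_< - q) (neg-involutive (f ω)) (neg-mono-< q<-f)

    measurable-|| : ∀ {f} → BorelMeasurable f → BorelMeasurable (λ ω → ∣ f ω ∣)
    measurable-|| {f} mf = measurable-∨ {f} {λ ω → - f ω} mf (measurable-neg mf)

    measurable-respects : ∀ {f g} → f ≗ g → BorelMeasurable f → BorelMeasurable g
    measurable-respects {f} {g} f≗g mf B B-borel = F-respects {f ⊢ B} {g ⊢ B}
      ((λ {ω} → subst B (f≗g ω)) , (λ {ω} → subst B (sym (f≗g ω)))) (mf B B-borel)

    measurable-scale-pos : ∀ {f c} → 0# < c → BorelMeasurable f → BorelMeasurable (λ ω → c * f ω)
    measurable-scale-pos {f} {c} 0<c mf = upper-rays⇒measurable λ q →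
      F-respects {λ ω → r * q < f ω} {λ ω → q < c * f ω} (to q , from q) (measurable-upper-ray mf (r * q))
      where
      r : ℝ
      r = proj₁ (recip 0<c)
      to : ∀ q → (λ ω → r * q < f ω) ⊆ (λ ω → q < c * f ω)
      to q {ω} rq<f = subst (_< c * f ω) (recip-cancel 0<c q) (*-monoˡ-< 0<c rq<f)
      from : ∀ q → (λ ω → q < c * f ω) ⊆ (λ ω → r * q < f ω)
      from q {ω} q<cf = *-cancelˡ-< 0<c (subst (_< c * f ω) (sym (recip-cancel 0<c q)) q<cf)

    measurable-scale : ∀ {f} c → BorelMeasurable f → BorelMeasurable (λ ω → c * f ω)
    measurable-scale {f} c mf with em {P = c ≡ 0#}
    ... | yes refl = measurable-respects (λ ω → sym (zeroˡ (f ω))) (measurable-const 0#)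
    ... | no c≢0 with total 0# c
    ...   | inj₁ 0≤c = measurable-scale-pos (0≤c , λ 0≡c → c≢0 (sym 0≡c)) mf
    ...   | inj₂ c≤0 = measurable-respects (λ ω → solve 2 (λ c f → (:- c) :* (:- f) := c :* f) refl c (f ω))
      (measurable-scale-pos (lin₁< (c≤0 , c≢0) (solve 1 (λ c → :- c :+ :- :0 := :0 :+ :- c) refl c)) (measurable-neg mf))

    measurable-⋎ : ∀ {g} {f : ℕ → Ω → ℝ} → BorelMeasurable g → (∀ n → BorelMeasurable (f n)) →
                   BorelMeasurable (λ ω → ⋎ (g ω) (λ n → f n ω))
    measurable-⋎ {g} {f} mg mf = upper-rays⇒measurable λ q →
        F-respects {⋃ ℕ (Both q)} {λ ω → q < ⋎ (g ω) (λ n → f n ω)} (to q , from q)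
          (F-union (Both q) λ n → F-∩ {λ ω → q < f n ω} {λ ω → q < g ω}
            (measurable-upper-ray (mf n) q) (measurable-upper-ray mg q))
      where
      Both : ℝ → ℕ → Pred Ω 0ℓ
      Both q n ω = q < f n ω × q < g ω
      to : ∀ q → ⋃ ℕ (Both q) ⊆ (λ ω → q < ⋎ (g ω) (λ n → f n ω))
      to q {ω} (n , q<f , q<g) = <-≤-trans (<-∧ q<f q<g) (⋎-upper (g ω) (λ n → f n ω) n)
      from : ∀ q → (λ ω → q < ⋎ (g ω) (λ n → f n ω)) ⊆ ⋃ ℕ (Both q)
      from q {ω} q<⋎ = find em
        where
        find : Dec (⋃ ℕ (Both q) ω) → ⋃ ℕ (Both q) ω
        find (yes found) = found
        find (no none) = contradiction (⋎-least (g ω) (λ n → f n ω) q λ n → ≮⇒≥ λ q<∧ →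
          none (n , <-≤-trans q<∧ (x∧y≤x (f n ω) (g ω)) , <-≤-trans q<∧ (x∧y≤y (f n ω) (g ω)))) (<⇒≱ q<⋎)

  -- Integrability on a finite measure space

  open FiniteSums semiring
    using (sum; sum-cong-≗; ∑-distrib-+; *-distribˡ-sum; sum-replicate-zero)
  open AddSupremum _≤_ using ([_]; _≤⊤⁺; [≤]-injective)

  sum-mono : ∀ {n} {f g : Fin n → ℝ} → (∀ i → f i ≤ g i) → sum f ≤ sum g
  sum-mono {zero}  f≤g = ≤-refl
  sum-mono {suc n} f≤g = +-mono (f≤g zero) (sum-mono (f≤g ∘ suc))

  sum⁺-real : ∀ {n} {f : Fin n → ℝ⁺} {g : Fin n → ℝ} → (∀ i → f i ≡ [ g i ]) → sum⁺ f ≡ [ sum g ]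
  sum⁺-real {zero}  f≡g = refl
  sum⁺-real {suc n} f≡g = cong₂ _+⁺_ (f≡g zero) (sum⁺-real (f≡g ∘ suc))

  real-part : ℝ⁺ → ℝ
  real-part [ x ] = x
  real-part ⊤⁺    = 0#

  -- The axiom `complete` takes predicates of level 0 only.
  Squash : ∀ {ℓ} → Set ℓ → Set
  Squash A with em {P = A}
  ... | yes _ = ⊤
  ... | no _  = Empty.⊥

  squash : ∀ {ℓ} {A : Set ℓ} → A → Squash A
  squash {A = A} x with em {P = A}
  ... | yes _ = tt
  ... | no ¬x = ¬x x

  unsquash : ∀ {ℓ} {A : Set ℓ} → Squash A → A
  unsquash {A = A} s with em {P = A}
  ... | yes x = x

  module FiniteMeasure (M : MeasureSpace) (finite : Finite M) where
    open MeasureSpace M public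
    open SigmaAlgebra isσAlgebra public

    m : Pred Ω 0ℓ → ℝ
    m A = real-part (μ A)

    -- Finite additivity is drawn from `μ-additive` by padding two sets with empty ones.
    sequence : Pred Ω 0ℓ → Pred Ω 0ℓ → ℕ → Pred Ω 0ℓ
    sequence A B zero          = A
    sequence A B (suc zero)    = B
    sequence A B (suc (suc _)) = ∅

    sequence-measurable : ∀ {A B} → F A → F B → ∀ n → F (sequence A B n)
    sequence-measurable FA FB zero          = FA
    sequence-measurable FA FB (suc zero)    = FB
    sequence-measurable FA FB (suc (suc _)) = F-∅

    sequence-disjoint : ∀ {A B} → A ⊥ B → ∀ m n → m ≢ n → sequence A B m ⊥ sequence A B n
    sequence-disjoint A⊥B zero          zero          m≢n _          = m≢n refl
    sequence-disjoint A⊥B (suc zero)    (suc zero)    m≢n _          = m≢n refl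
    sequence-disjoint A⊥B zero          (suc zero)    m≢n (a , b)    = A⊥B (a , b)
    sequence-disjoint A⊥B (suc zero)    zero          m≢n (b , a)    = A⊥B (a , b)
    sequence-disjoint A⊥B (suc (suc _)) _             m≢n (() , _)
    sequence-disjoint A⊥B zero          (suc (suc _)) m≢n (_ , ())
    sequence-disjoint A⊥B (suc zero)    (suc (suc _)) m≢n (_ , ())

    -- The partial sum of length 1 of A, ∁ A, ∅, ... is μ A + 0, and it is bounded by the finite
    -- value μ U.
    μ≡m : ∀ {A} → F A → μ A ≡ [ m A ]
    μ≡m {A} FA = finite-part (μ A) (subst (μ A +⁺ [ 0# ] ≤⁺_)
        (trans (sym (μ-cong F-whole ((λ {ω} _ → cover ω em) , λ _ → tt))) (proj₂ finite))
        (proj₁ (μ-additive (sequence A (∁ A)) (sequence-measurable FA (F-complement FA))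
          (sequence-disjoint λ { (a , ¬a) → ¬a a })) _ (1 , refl)))
      where
      cover : ∀ ω → Dec (A ω) → ⋃ ℕ (sequence A (∁ A)) ω
      cover ω (yes a) = 0 , a
      cover ω (no ¬a) = 1 , ¬a
      finite-part : ∀ x → x +⁺ [ 0# ] ≤⁺ [ proj₁ finite ] → x ≡ [ real-part x ]
      finite-part [ x ] _ = refl

    m-cong : ∀ {A B} → F A → A ≐ B → m A ≡ m B
    m-cong FA A≐B = cong real-part (μ-cong FA A≐B)

    m-nonneg : ∀ {A} → F A → 0# ≤ m A
    m-nonneg FA = [≤]-injective (subst ([ 0# ] ≤⁺_) (μ≡m FA) (μ-nonneg FA))

    m-∅ : m ∅ ≡ 0#
    m-∅ = cong real-part μ-empty

    -- The two inequalities are the two halves of the least upper bound property: no partial sum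
    -- exceeds the sum of the two measures, and the partial sum of length 2 attains it.
    m-split : ∀ {A E} → F A → F E → m A ≡ m (A ∩ E) + m (A ∩ ∁ E)
    m-split {A} {E} FA FE = ≤-antisym
        ([≤]-injective (subst (_≤⁺ [ m A₁ + m A₂ ]) (trans (sym (μ-cong FA A≐⋃)) (μ≡m FA))
          (proj₂ lub [ m A₁ + m A₂ ] λ { _ (n , refl) → subst (_≤⁺ [ m A₁ + m A₂ ]) (sym (partial n)) [ partial≤ n ] })))
        (subst (_≤ m A) (cong (m A₁ +_) (+-identityʳ (m A₂)))
          ([≤]-injective (subst₂ _≤⁺_ (partial 2) (trans (sym (μ-cong FA A≐⋃)) (μ≡m FA)) (proj₁ lub _ (2 , refl)))))
      where
      A₁ = A ∩ E
      A₂ = A ∩ ∁ E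
      FA₁ : F A₁
      FA₁ = F-∩ FA FE
      FA₂ : F A₂
      FA₂ = F-∩ FA (F-complement FE)
      measurable = sequence-measurable FA₁ FA₂
      lub = μ-additive (sequence A₁ A₂) measurable (sequence-disjoint λ { ((_ , e) , (_ , ¬e)) → ¬e e })
      pieces : ∀ ω → A ω → Dec (E ω) → ⋃ ℕ (sequence A₁ A₂) ω
      pieces ω a (yes e) = 0 , a , e
      pieces ω a (no ¬e) = 1 , a , ¬e
      A≐⋃ : A ≐ ⋃ ℕ (sequence A₁ A₂)
      A≐⋃ = (λ {ω} a → pieces ω a em) , λ { (zero , a , _) → a ; (suc zero , a , _) → a ; (suc (suc _) , ()) }
      partial : ∀ n → sum⁺ {n} (λ i → μ (sequence A₁ A₂ (toℕ i))) ≡ [ sum {n} (λ i → m (sequence A₁ A₂ (toℕ i))) ]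
      partial n = sum⁺-real {n} λ i → μ≡m (measurable (toℕ i))
      partial≤ : ∀ n → sum {n} (λ i → m (sequence A₁ A₂ (toℕ i))) ≤ m A₁ + m A₂
      partial≤ zero          = +-nonneg (m-nonneg FA₁) (m-nonneg FA₂)
      partial≤ (suc zero)    = +-mono ≤-refl (m-nonneg FA₂)
      partial≤ (suc (suc n)) = +-mono ≤-refl (≤-reflexive (trans
        (cong (m A₂ +_) (trans (sum-cong-≗ {n} (λ _ → m-∅)) (sum-replicate-zero n))) (+-identityʳ (m A₂))))

    m-mono : ∀ {A B} → F A → F B → A ⊆ B → m A ≤ m B
    m-mono {A} {B} FA FB A⊆B = subst₂ _≤_ (+-identityʳ (m A))
      (trans (cong (_+ m (B ∩ ∁ A)) (m-cong FA ((λ a → A⊆B a , a) , proj₂))) (sym (m-split FB FA)))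
      (+-mono ≤-refl (m-nonneg (F-∩ FB (F-complement FA))))

    -- By induction: E is split along the first piece, and the others lie in the remainder.
    Σm-disjoint≤ : ∀ {n E} (P : Fin n → Pred Ω 0ℓ) → F E → (∀ i → F (P i)) → (∀ i → P i ⊆ E) →
                   (∀ i j → i ≢ j → P i ⊥ P j) → sum (m ∘ P) ≤ m E
    Σm-disjoint≤ {zero}      P FE FP P⊆E disj = m-nonneg FE
    Σm-disjoint≤ {suc n} {E} P FE FP P⊆E disj = ≤-trans
      (+-mono (m-mono (FP zero) (F-∩ FE (FP zero)) λ p → P⊆E zero p , p)
        (Σm-disjoint≤ (P ∘ suc) (F-∩ FE (F-complement (FP zero))) (FP ∘ suc)
          (λ i p → P⊆E (suc i) p , λ p₀ → disj zero (suc i) (λ ()) (p₀ , p))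
          (λ i j i≢j → disj (suc i) (suc j) (i≢j ∘ Fin.suc-injective))))
      (≤-reflexive (sym (m-split FE (FP zero))))

    Simple : Set₁
    Simple = SimpleFunction M

    open SimpleFunction public

    integral : Simple → ℝ
    integral s = sum λ i → coeff s i * m (piece s i)

    ∫ₛ≡integral : ∀ s → ∫ₛ M s ≡ [ integral s ]
    ∫ₛ≡integral s = sum⁺-real {size s} λ i → cong (coeff s i *⁺_) (μ≡m (piece-measurable s i))

    -- Integrability as boundedness of the lower sums

    LowerSumsBounded : (Ω → ℝ) → Set₁
    LowerSumsBounded φ = ∃[ C ] ∀ s → _Below_ M s φ → integral s ≤ C

    restrict : Simple → ∀ {E} → F E → Simple
    restrict s {E} FE = record
      { size             = size s
      ; coeff            = coeff s
      ; piece            = λ i → piece s i ∩ E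
      ; coeff-positive   = coeff-positive s
      ; piece-measurable = λ i → F-∩ (piece-measurable s i) FE
      ; piece-disjoint   = λ i j i≢j ((p , _) , (q , _)) → piece-disjoint s i j i≢j (p , q)
      }

    integral-split : ∀ s {E} (FE : F E) →
      integral s ≡ integral (restrict s FE) + integral (restrict s (F-complement FE))
    integral-split s {E} FE = trans
      (sum-cong-≗ {size s} λ i → trans (cong (coeff s i *_) (m-split (piece-measurable s i) FE)) (distribˡ (coeff s i) _ _))
      (∑-distrib-+ {size s} (λ i → coeff s i * m (piece s i ∩ E)) (λ i → coeff s i * m (piece s i ∩ ∁ E)))

    -- Replaces additivity of the integral: a simple function below φ is cut into its parts on E and
    -- off E, and each part only has to be below its own bound.
    bounded-split : ∀ {E φ ψ₁ ψ₂} → F E → (∀ ω → E ω → φ ω ≤ ψ₁ ω) → (∀ ω → ¬ E ω → φ ω ≤ ψ₂ ω) →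
      LowerSumsBounded ψ₁ → LowerSumsBounded ψ₂ → LowerSumsBounded φ
    bounded-split FE φ≤ψ₁ φ≤ψ₂ (C₁ , b₁) (C₂ , b₂) = C₁ + C₂ , λ s s≤φ →
      ≤-trans (≤-reflexive (integral-split s FE)) (+-mono
        (b₁ (restrict s FE) λ i ω (p , e) → ≤-trans (s≤φ i ω p) (φ≤ψ₁ ω e))
        (b₂ (restrict s (F-complement FE)) λ i ω (p , ¬e) → ≤-trans (s≤φ i ω p) (φ≤ψ₂ ω ¬e)))

    bounded-mono : ∀ {φ ψ} → (∀ ω → φ ω ≤ ψ ω) → LowerSumsBounded ψ → LowerSumsBounded φ
    bounded-mono φ≤ψ (C , b) = C , λ s s≤φ → b s λ i ω p → ≤-trans (s≤φ i ω p) (φ≤ψ ω)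

    bounded-scale : ∀ {ψ K} → 0# < K → LowerSumsBounded ψ → LowerSumsBounded (λ ω → K * ψ ω)
    bounded-scale {ψ} {K} 0<K (C , b) = K * C , λ s s≤Kψ →
      ≤-trans (≤-reflexive (sym (trans (cong (K *_) (integral-scaled s)) (recip-cancel 0<K (integral s)))))
        (*-monoˡ (proj₁ 0<K) (b (scaled s) λ i ω p → ≤-trans (*-monoˡ (proj₁ 0<r) (s≤Kψ i ω p)) (≤-reflexive (r*K* (ψ ω)))))
      where
      r   = proj₁ (recip 0<K)
      0<r = proj₁ (proj₂ (recip 0<K))
      r*K* : ∀ x → r * (K * x) ≡ x
      r*K* x = trans (solve 3 (λ r K x → r :* (K :* x) := K :* (r :* x)) refl r K x) (recip-cancel 0<K x)
      scaled : Simple → Simple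
      scaled s = record
        { size             = size s
        ; coeff            = λ i → r * coeff s i
        ; piece            = piece s
        ; coeff-positive   = λ i → *-pos 0<r (coeff-positive s i)
        ; piece-measurable = piece-measurable s
        ; piece-disjoint   = piece-disjoint s
        }
      integral-scaled : ∀ s → integral (scaled s) ≡ r * integral s
      integral-scaled s = trans (sum-cong-≗ {size s} λ i → *-assoc r (coeff s i) _) (sym (*-distribˡ-sum {size s} r (λ i → coeff s i * m (piece s i))))

    bounded-const : ∀ {c} → 0# ≤ c → LowerSumsBounded (λ _ → c)
    bounded-const {c} 0≤c = c * m U , λ s s≤c → ≤-trans (sum-mono {size s} (term s s≤c))
      (≤-trans (≤-reflexive (sym (*-distribˡ-sum {size s} c (m ∘ piece s))))
        (*-monoˡ 0≤c (Σm-disjoint≤ (piece s) F-whole (piece-measurable s) (λ _ _ → tt) (piece-disjoint s))))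
      where
      term : ∀ s → _Below_ M s (λ _ → c) → ∀ i → coeff s i * m (piece s i) ≤ c * m (piece s i)
      term s s≤c i with em {P = ∃ (piece s i)}
      ... | yes (ω , p) = *-monoʳ (m-nonneg (piece-measurable s i)) (s≤c i ω p)
      -- On an empty piece s ≤ c says nothing about the coefficient, but the piece has measure 0.
      ... | no empty    = ≤-reflexive (trans (zero-measure (coeff s i)) (sym (zero-measure c)))
        where
        zero-measure : ∀ x → x * m (piece s i) ≡ 0#
        zero-measure x = trans (cong (x *_) (trans (m-cong (piece-measurable s i) ((λ p → empty (_ , p)) , λ ())) m-∅)) (zeroʳ x)

    bounded⇒integral : ∀ {φ} → LowerSumsBounded φ → ∃[ r ] IsIntegral M φ [ r ]
    bounded⇒integral {φ} (C , b) = r , upper , least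
      where
      Value : Pred ℝ 0ℓ
      Value x = Squash (∃[ s ] _Below_ M s φ × x ≡ integral s)
      none : Simple
      none = record { size = 0 ; coeff = λ () ; piece = λ () ; coeff-positive = λ ()
                    ; piece-measurable = λ () ; piece-disjoint = λ () }
      value≤C : ∀ x → Value x → x ≤ C
      value≤C x x∈ = let s , s≤φ , x≡ = unsquash x∈ in ≤-trans (≤-reflexive x≡) (b s s≤φ)
      lub = complete Value (0# , squash (none , (λ ()) , refl)) (C , value≤C)
      r = proj₁ lub
      upper : ∀ x → (∃[ s ] _Below_ M s φ × x ≡ ∫ₛ M s) → x ≤⁺ [ r ]
      upper _ (s , s≤φ , refl) = subst (_≤⁺ [ r ]) (sym (∫ₛ≡integral s))
        [ proj₁ (proj₂ lub) (integral s) (squash (s , s≤φ , refl)) ]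
      least : ∀ b → (∀ x → (∃[ s ] _Below_ M s φ × x ≡ ∫ₛ M s) → x ≤⁺ b) → [ r ] ≤⁺ b
      least ⊤⁺    _  = _ ≤⊤⁺
      least [ b ] ub = [ proj₂ (proj₂ lub) b (λ x x∈ → let s , s≤φ , x≡ = unsquash x∈ in
        ≤-trans (≤-reflexive x≡) ([≤]-injective (subst (_≤⁺ [ b ]) (∫ₛ≡integral s) (ub _ (s , s≤φ , refl))))) ]

    integral⇒bounded : ∀ {φ r} → IsIntegral M φ [ r ] → LowerSumsBounded φ
    integral⇒bounded {r = r} (upper , _) = r , λ s s≤φ →
      [≤]-injective (subst (_≤⁺ [ r ]) (∫ₛ≡integral s) (upper _ (s , s≤φ , refl)))

    module Integrability (p : ℝ) (1≤p : 1# ≤ p) where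
      open RealPower p 1≤p public

      -- On a finite measure space ∣ f ∣ ^ʳ p may be replaced by (1# ∨ ∣ f ∣) ^ʳ p,
      -- so that only powers of numbers ≥ 1 have to be dealt with.
      1∨∣_∣^p : (Ω → ℝ) → Ω → ℝ
      1∨∣ f ∣^p ω = (1# ∨ ∣ f ω ∣) ^ʳ p

      1≤1∨ : ∀ x → 1# ≤ 1# ∨ x
      1≤1∨ x = x≤x∨y 1# x

      member : ∀ {f} → BorelMeasurable f → LowerSumsBounded 1∨∣ f ∣^p → 𝓛 M p f
      member {f} mf b = mf , bounded⇒integral (bounded-mono le b)
        where
        le : ∀ ω → ∣ f ω ∣ ^ʳ p ≤ (1# ∨ ∣ f ω ∣) ^ʳ p
        le ω = [ (λ 1≤|f| → ^ʳ-mono 1≤|f| (y≤x∨y 1# ∣ f ω ∣))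
               , (λ |f|≤1 → ≤-trans (x^ʳp≤1 (0≤|x| (f ω)) |f|≤1) (1≤x^ʳp (1≤1∨ ∣ f ω ∣))) ]′ (total 1# ∣ f ω ∣)

      -- The maximum is |f| where |f| > 1 and the constant 1 elsewhere; lower sums of a constant are
      -- bounded because the measure is finite.
      member-bounded : ∀ {f} → 𝓛 M p f → LowerSumsBounded 1∨∣ f ∣^p
      member-bounded {f} (mf , _ , isIntegral) = bounded-split
          (measurable-upper-ray (measurable-|| mf) 1#)
          (λ ω 1<|f| → ^ʳ-mono (1≤1∨ _) (∨-lub (proj₁ 1<|f|) ≤-refl))
          (λ ω 1≮|f| → ^ʳ-mono (1≤1∨ _) (∨-lub ≤-refl (≮⇒≥ 1≮|f|)))
          (integral⇒bounded isIntegral) (bounded-const (≤-trans 0≤1 (1≤x^ʳp ≤-refl)))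

      -- The integrability criterion behind all basic operations. Where |f| > |g| the bound involves
      -- f alone, and elsewhere g alone, so `bounded-split` applies; the factor `2#` becomes 2ᴺ by
      -- `^ʳ-double-≤`.
      dominated : ∀ {f g h} → 𝓛 M p f → 𝓛 M p g → BorelMeasurable h →
                  (∀ ω → ∣ h ω ∣ ≤ 2# * (1# ∨ (∣ f ω ∣ ∨ ∣ g ω ∣))) → 𝓛 M p h
      dominated {f} {g} {h} Lf Lg mh |h|≤ = member mh (bounded-split
          (measurable-upper-ray (measurable-+ (measurable-|| (proj₁ Lf)) (measurable-neg (measurable-|| (proj₁ Lg)))) 0#)
          (λ ω 0<|f|-|g| → le ω _ (∨-lub (x≤x∨y 1# _) (∨-lub (y≤x∨y 1# _)
            (≤-trans (lin₁ (proj₁ 0<|f|-|g|) (solve 2 (λ f g → f :+ :- g := f :+ :- g :+ :- :0) refl (∣ f ω ∣) (∣ g ω ∣))) (y≤x∨y 1# _)))))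
          (λ ω 0≮|f|-|g| → le ω _ (∨-lub (x≤x∨y 1# _) (∨-lub
            (≤-trans (lin₁ (≮⇒≥ 0≮|f|-|g|) (solve 2 (λ f g → g :+ :- f := :0 :+ :- (f :+ :- g)) refl (∣ f ω ∣) (∣ g ω ∣))) (y≤x∨y 1# _)) (y≤x∨y 1# _))))
          (bounded-scale (^-pos N 0<2) (member-bounded Lf))
          (bounded-scale (^-pos N 0<2) (member-bounded Lg)))
        where
        le : ∀ ω v → 1# ∨ (∣ f ω ∣ ∨ ∣ g ω ∣) ≤ 1# ∨ v → (1# ∨ ∣ h ω ∣) ^ʳ p ≤ 2# ^ N * (1# ∨ v) ^ʳ p
        le ω v ≤v = ≤-trans (^ʳ-mono (1≤1∨ _) (∨-lub (1≤2u (1≤1∨ v))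
            (≤-trans (|h|≤ ω) (*-monoˡ (proj₁ 0<2) ≤v)))) (^ʳ-double-≤ (1≤1∨ v))

  -- Closure of 𝓛 under the basic operations

  |c*x|≤|k*x| : ∀ {c k} x → ∣ c ∣ ≤ k → ∣ c * x ∣ ≤ ∣ k * x ∣
  |c*x|≤|k*x| {c} {k} x |c|≤k = [ nonneg , nonpos ]′ (total 0# x)
    where
    c≤k : c ≤ k
    c≤k = ≤-trans (x≤|x| c) |c|≤k
    -c≤k : - c ≤ k
    -c≤k = ≤-trans (-x≤|x| c) |c|≤k
    nonneg : 0# ≤ x → ∣ c * x ∣ ≤ ∣ k * x ∣
    nonneg 0≤x = |x|-lub
      (≤-trans (*-monoʳ 0≤x c≤k) (x≤|x| _))
      (≤-trans (≤-trans (≤-reflexive (solve 2 (λ c x → :- (c :* x) := (:- c) :* x) refl c x)) (*-monoʳ 0≤x -c≤k)) (x≤|x| _))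
    nonpos : x ≤ 0# → ∣ c * x ∣ ≤ ∣ k * x ∣
    nonpos x≤0 = |x|-lub
      (≤-trans (lin₁ (*-monoʳ 0≤-x -c≤k) (solve 3 (λ c k x → (:- (k :* x)) :+ :- (c :* x) := k :* (:- x) :+ :- ((:- c) :* (:- x))) refl c k x)) (-x≤|x| _))
      (≤-trans (lin₁ (*-monoʳ 0≤-x c≤k) (solve 3 (λ c k x → (:- (k :* x)) :+ :- (:- (c :* x)) := k :* (:- x) :+ :- (c :* (:- x))) refl c k x)) (-x≤|x| _))
      where
      0≤-x : 0# ≤ - x
      0≤-x = lin₁ x≤0 (solve 1 (λ x → :- x :+ :- :0 := :0 :+ :- x) refl x)

  v≤2[1∨v] : ∀ v → v ≤ 2# * (1# ∨ v)
  v≤2[1∨v] v = ≤-trans (y≤x∨y 1# v) (lin₁ (≤-trans 0≤1 (x≤x∨y 1# v))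
    (solve 1 (λ w → (:1 :+ :1) :* w :+ :- w := w :+ :- :0) refl (1# ∨ v)))

  |x+y|≤2[1∨|x|∨|y|] : ∀ x y → ∣ x + y ∣ ≤ 2# * (1# ∨ (∣ x ∣ ∨ ∣ y ∣))
  |x+y|≤2[1∨|x|∨|y|] x y = |x|-lub (twice (≤-trans (x≤|x| x) ≤w₁) (≤-trans (x≤|x| y) ≤w₂))
      (subst (_≤ 2# * w) (solve 2 (λ x y → :- x :+ :- y := :- (x :+ y)) refl x y)
        (twice (≤-trans (-x≤|x| x) ≤w₁) (≤-trans (-x≤|x| y) ≤w₂)))
    where
    w = 1# ∨ (∣ x ∣ ∨ ∣ y ∣)
    ≤w₁ : ∣ x ∣ ≤ w
    ≤w₁ = ≤-trans (x≤x∨y (∣ x ∣) (∣ y ∣)) (y≤x∨y 1# _)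
    ≤w₂ : ∣ y ∣ ≤ w
    ≤w₂ = ≤-trans (y≤x∨y (∣ x ∣) (∣ y ∣)) (y≤x∨y 1# _)
    twice : ∀ {a b} → a ≤ w → b ≤ w → a + b ≤ 2# * w
    twice a≤w b≤w = ≤-trans (+-mono a≤w b≤w) (≤-reflexive (solve 1 (λ w → w :+ w := (:1 :+ :1) :* w) refl w))

  |x∨y|≤|x|∨|y| : ∀ x y → ∣ x ∨ y ∣ ≤ ∣ x ∣ ∨ ∣ y ∣
  |x∨y|≤|x|∨|y| x y = |x|-lub (∨-mono (x≤|x| x) (x≤|x| y))
    (≤-trans (neg-mono (x≤x∨y x y)) (≤-trans (-x≤|x| x) (x≤x∨y (∣ x ∣) (∣ y ∣))))

  -- The truncated supremum lies between x₀ ∧ y and y, so two of its infinitely many arguments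
  -- dominate it.
  |⋎|≤|x₀|∨|y| : ∀ y x → ∣ ⋎ y x ∣ ≤ ∣ x 0 ∣ ∨ ∣ y ∣
  |⋎|≤|x₀|∨|y| y x = |x|-lub
      (≤-trans (⋎-least y x y λ n → x∧y≤y (x n) y) (≤-trans (x≤|x| y) (y≤x∨y (∣ x 0 ∣) (∣ y ∣))))
      (≤-trans (neg-mono (⋎-upper y x 0)) -∧≤)
    where
    -∧≤ : - (x 0 ∧ y) ≤ ∣ x 0 ∣ ∨ ∣ y ∣
    -∧≤ = [ (λ e → ≤-trans (≤-reflexive (cong -_ e)) (≤-trans (-x≤|x| (x 0)) (x≤x∨y (∣ x 0 ∣) (∣ y ∣))))
          , (λ e → ≤-trans (≤-reflexive (cong -_ e)) (≤-trans (-x≤|x| y) (y≤x∨y (∣ x 0 ∣) (∣ y ∣)))) ]′ (∧-sel (x 0) y)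

  module Closure (M : MeasureSpace) (finite : Finite M) (p : ℝ) (1≤p : 1# ≤ p) where
    open FiniteMeasure M finite public
    open Integrability p 1≤p public

    𝓛-const : ∀ c → 𝓛 M p (λ _ → c)
    𝓛-const c = member (measurable-const c) (bounded-const (≤-trans 0≤1 (1≤x^ʳp (1≤1∨ _))))

    𝓛-+ : ∀ {f g} → 𝓛 M p f → 𝓛 M p g → 𝓛 M p (λ ω → f ω + g ω)
    𝓛-+ {f} {g} Lf Lg = dominated Lf Lg (measurable-+ (proj₁ Lf) (proj₁ Lg)) λ ω → |x+y|≤2[1∨|x|∨|y|] (f ω) (g ω)

    𝓛-dominated : ∀ {f g h} → 𝓛 M p f → 𝓛 M p g → BorelMeasurable h →
                  (∀ ω → ∣ h ω ∣ ≤ ∣ f ω ∣ ∨ ∣ g ω ∣) → 𝓛 M p h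
    𝓛-dominated Lf Lg mh |h|≤ = dominated Lf Lg mh λ ω → ≤-trans (|h|≤ ω) (v≤2[1∨v] _)

    𝓛-respects : ∀ {f g} → f ≗ g → 𝓛 M p f → 𝓛 M p g
    𝓛-respects f≗g Lf = 𝓛-dominated Lf Lf (measurable-respects f≗g (proj₁ Lf))
      λ ω → ≤-trans (≤-reflexive (cong ∣_∣ (sym (f≗g ω)))) (x≤x∨y _ _)

    𝓛-multiple : ∀ {f} n → 𝓛 M p f → 𝓛 M p (λ ω → ⌜ n ⌝ * f ω)
    𝓛-multiple {f} zero    Lf = 𝓛-respects (λ ω → sym (zeroˡ (f ω))) (𝓛-const 0#)
    𝓛-multiple {f} (suc n) Lf = 𝓛-respects
      (λ ω → solve 2 (λ n f → f :+ n :* f := (:1 :+ n) :* f) refl ⌜ n ⌝ (f ω)) (𝓛-+ Lf (𝓛-multiple n Lf))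

    -- For a natural number n > |c| the function n f, a repeated sum, dominates c f.
    𝓛-scale : ∀ {f} c → 𝓛 M p f → 𝓛 M p (λ ω → c * f ω)
    𝓛-scale {f} c Lf = let n , |c|<n = archimedean (∣ c ∣)
                           Lnf = 𝓛-multiple n Lf
      in 𝓛-dominated Lnf Lnf (measurable-scale c (proj₁ Lf))
           λ ω → ≤-trans (|c*x|≤|k*x| (f ω) (proj₁ |c|<n)) (x≤x∨y _ _)

    𝓛-closed : ∀ {K τ} → BasicOperation K τ → ClosedUnder (𝓛 M p) τ
    𝓛-closed zero-op      f Lf = 𝓛-const 0#
    𝓛-closed plus-op      f Lf = 𝓛-+ (Lf zero) (Lf (suc zero))
    𝓛-closed join-op      f Lf = 𝓛-dominated (Lf zero) (Lf (suc zero))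
      (measurable-∨ (proj₁ (Lf zero)) (proj₁ (Lf (suc zero)))) λ ω → |x∨y|≤|x|∨|y| _ _
    𝓛-closed (scale-op c) f Lf = 𝓛-scale c (Lf zero)
    𝓛-closed sup-op       f Lf = 𝓛-dominated (Lf 1) (Lf 0)
      (measurable-⋎ (proj₁ (Lf 0)) (λ n → proj₁ (Lf (suc n)))) λ ω → |⋎|≤|x₀|∨|y| _ _
    𝓛-closed one-op       f Lf = 𝓛-const 1#

    𝓛-closed-generated : ∀ {I} {τ : Operation I} → Generated BasicOperation τ → ClosedUnder (𝓛 M p) τ
    𝓛-closed-generated (projection i)    φ Lφ = Lφ i
    𝓛-closed-generated (closed op f gen) φ Lφ = 𝓛-closed op _ λ i → 𝓛-closed-generated (gen i) φ Lφ
    𝓛-closed-generated (pointwise f≗g gen) φ Lφ = 𝓛-respects (λ ω → f≗g _) (𝓛-closed-generated gen φ Lφ)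

  generated⇒preserves : ∀ {I p} {τ : Operation I} → 1# ≤ p → Generated BasicOperation τ → PreservesIntegrability p τ
  generated⇒preserves {p = p} 1≤p gen M finite = Closure.𝓛-closed-generated M finite p 1≤p gen

  -- Generated functions and generated sets

  indicator : {X : Set} → Pred X 0ℓ → X → ℝ
  indicator A x with em {P = A x}
  ... | yes _ = 1#
  ... | no _  = 0#

  indicator-∈ : ∀ {X : Set} {A : Pred X 0ℓ} {x} → A x → indicator A x ≡ 1#
  indicator-∈ {A = A} {x} a with em {P = A x}
  ... | yes _ = refl
  ... | no ¬a = contradiction a ¬a

  indicator-∉ : ∀ {X : Set} {A : Pred X 0ℓ} {x} → ¬ A x → indicator A x ≡ 0#
  indicator-∉ {A = A} {x} ¬a with em {P = A x}
  ... | yes a = contradiction a ¬a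
  ... | no _  = refl

  indicator-unique : ∀ {X : Set} {A : Pred X 0ℓ} {x y} → (A x → y ≡ 1#) → (¬ A x → y ≡ 0#) → y ≡ indicator A x
  indicator-unique {A = A} {x} one zer with em {P = A x}
  ... | yes a = one a
  ... | no ¬a = zer ¬a

  indicator-nonneg : ∀ {X : Set} (A : Pred X 0ℓ) x → 0# ≤ indicator A x
  indicator-nonneg A x with em {P = A x}
  ... | yes _ = 0≤1
  ... | no _  = ≤-refl

  indicator-1⇒∈ : ∀ {X : Set} {A : Pred X 0ℓ} {x} → indicator A x ≡ 1# → A x
  indicator-1⇒∈ {A = A} {x} e with em {P = A x}
  ... | yes a = a
  ... | no _  = contradiction e 0≢1

  module Generation {I : Set} where

    𝒢 : Pred (Operation I) (lsuc 0ℓ)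
    𝒢 = Generated BasicOperation

    pair : {A : Set} → A → A → Fin 2 → A
    pair a b zero    = a
    pair a b (suc _) = b

    𝒢-pair : ∀ {f g} → 𝒢 f → 𝒢 g → ∀ i → 𝒢 (pair f g i)
    𝒢-pair Gf Gg zero    = Gf
    𝒢-pair Gf Gg (suc _) = Gg

    𝒢-+ : ∀ {f g} → 𝒢 f → 𝒢 g → 𝒢 (λ x → f x + g x)
    𝒢-+ {f} {g} Gf Gg = closed plus-op (pair f g) (𝒢-pair Gf Gg)

    𝒢-∨ : ∀ {f g} → 𝒢 f → 𝒢 g → 𝒢 (λ x → f x ∨ g x)
    𝒢-∨ {f} {g} Gf Gg = closed join-op (pair f g) (𝒢-pair Gf Gg)

    𝒢-scale : ∀ {f} c → 𝒢 f → 𝒢 (λ x → c * f x)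
    𝒢-scale {f} c Gf = closed (scale-op c) (λ _ → f) (λ _ → Gf)

    𝒢-⋎ : ∀ {g} {f : ℕ → Operation I} → 𝒢 g → (∀ n → 𝒢 (f n)) → 𝒢 (λ x → ⋎ (g x) (λ n → f n x))
    𝒢-⋎ {g} {f} Gg Gf = closed sup-op arguments λ { zero → Gg ; (suc n) → Gf n }
      where
      arguments : ℕ → Operation I
      arguments zero    = g
      arguments (suc n) = f n

    𝒢-1 : 𝒢 (λ _ → 1#)
    𝒢-1 = closed one-op (λ ()) (λ ())

    𝒢-const : ∀ c → 𝒢 (λ _ → c)
    𝒢-const c = pointwise (λ _ → *-identityʳ c) (𝒢-scale c 𝒢-1)

    𝒢-neg : ∀ {f} → 𝒢 f → 𝒢 (λ x → - f x)
    𝒢-neg {f} Gf = pointwise (λ x → solve 1 (λ y → (:- :1) :* y := :- y) refl (f x)) (𝒢-scale (- 1#) Gf)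

    𝒢-|| : ∀ {f} → 𝒢 f → 𝒢 (λ x → ∣ f x ∣)
    𝒢-|| Gf = 𝒢-∨ Gf (𝒢-neg Gf)

    ⋎≡1 : ∀ {x : ℕ → ℝ} n → 1# ≤ x n → ⋎ 1# x ≡ 1#
    ⋎≡1 {x} n 1≤xn = ≤-antisym (⋎-least 1# x 1# λ k → x∧y≤y (x k) 1#)
      (≤-trans (∧-glb 1≤xn ≤-refl) (⋎-upper 1# x n))

    ⋎≡0 : ∀ {x : ℕ → ℝ} → (∀ n → x n ≡ 0#) → ⋎ 1# x ≡ 0#
    ⋎≡0 {x} x≡0 = ≤-antisym (⋎-least 1# x 0# λ k → ≤-trans (x∧y≤x (x k) 1#) (≤-reflexive (x≡0 k)))
      (≤-trans (∧-glb (≤-reflexive (sym (x≡0 0))) 0≤1) (⋎-upper 1# x 0))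

    GeneratedSet : Pred (Pred (I → ℝ) 0ℓ) (lsuc 0ℓ)
    GeneratedSet A = 𝒢 (indicator A)

    -- The constant 1 yields the whole space and complements, as 1 minus an indicator. For unions,
    -- `⋎` with first argument 1 is the supremum of the indicators, as these never exceed 1.
    generatedSet-isσAlgebra : IsσAlgebra GeneratedSet
    generatedSet-isσAlgebra = record
      { F-respects   = λ {A} {B} (A⊆B , B⊆A) → pointwise λ x →
          indicator-unique {A = B} (λ b → indicator-∈ {A = A} (B⊆A b)) (λ ¬b → indicator-∉ {A = A} (¬b ∘ A⊆B))
      ; F-whole      = pointwise (λ x → indicator-unique {A = U} (λ _ → refl) (λ ¬⊤ → contradiction tt ¬⊤)) 𝒢-1
      ; F-complement = λ {A} GA → pointwise (λ x → indicator-unique {A = ∁ A}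
          (λ ¬a → trans (cong (λ z → 1# + - z) (indicator-∉ {A = A} ¬a)) (solve 0 (:1 :+ :- :0 := :1) refl))
          (λ ¬¬a → trans (cong (λ z → 1# + - z) (indicator-∈ {A = A} (¬¬-elim ¬¬a))) (-‿inverseʳ 1#)))
          (𝒢-+ 𝒢-1 (𝒢-neg GA))
      ; F-union      = λ A GA → pointwise (λ x → indicator-unique {A = ⋃ ℕ A}
          (λ { (n , a) → ⋎≡1 n (≤-reflexive (sym (indicator-∈ {A = A n} a))) })
          (λ ¬a → ⋎≡0 λ n → indicator-∉ {A = A n} λ a → ¬a (n , a)))
          (𝒢-⋎ 𝒢-1 GA)
      }
      where
      ¬¬-elim : ∀ {P : Set} → ¬ ¬ P → P
      ¬¬-elim {P} ¬¬p with em {P = P}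
      ... | yes p = p
      ... | no ¬p = contradiction ¬p ¬¬p

    open SigmaAlgebra generatedSet-isσAlgebra public

    -- The indicator of {f > 0} is the truncated supremum of the multiples of f ∨ 0.
    positive-set : ∀ {f} → 𝒢 f → GeneratedSet (λ x → 0# < f x)
    positive-set {f} Gf = pointwise (λ x → indicator-unique {A = λ x → 0# < f x} (one x) (none x))
      (𝒢-⋎ 𝒢-1 λ n → 𝒢-scale ⌜ n ⌝ (𝒢-∨ Gf (𝒢-const 0#)))
      where
      one : ∀ x → 0# < f x → ⋎ 1# (λ n → ⌜ n ⌝ * (f x ∨ 0#)) ≡ 1#
      one x 0<f =
        case recip 0<f of λ (r , _ , fr≡1) →
        case archimedean r of λ (n , r<n) →
        ⋎≡1 {λ n → ⌜ n ⌝ * (f x ∨ 0#)} n (≤-trans (≤-reflexive (sym fr≡1)) (≤-trans (*-monoˡ (proj₁ 0<f) (proj₁ r<n))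
          (≤-trans (≤-reflexive (*-comm (f x) ⌜ n ⌝)) (*-monoˡ 0≤⌜ n ⌝ (x≤x∨y (f x) 0#)))))
      none : ∀ x → ¬ 0# < f x → ⋎ 1# (λ n → ⌜ n ⌝ * (f x ∨ 0#)) ≡ 0#
      none x 0≮f = ⋎≡0 λ n → trans (cong (⌜ n ⌝ *_)
        (≤-antisym (∨-lub (≮⇒≥ 0≮f) ≤-refl) (y≤x∨y (f x) 0#))) (zeroʳ ⌜ n ⌝)

    generated⇒measurable : ∀ {f} → 𝒢 f → BorelMeasurable f
    generated⇒measurable {f} Gf = upper-rays⇒measurable λ q →
      F-respects {λ x → 0# < f x + - q} {λ x → q < f x} (to q , 0<-diff) (positive-set (𝒢-+ Gf (𝒢-const (- q))))
      where
      to : ∀ q → (λ x → 0# < f x + - q) ⊆ (λ x → q < f x)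
      to q {x} 0<f-q = lin₁< 0<f-q (solve 2 (λ f q → f :+ :- q := f :+ :- q :+ :- :0) refl (f x) q)

    -- A nonnegative σ is the supremum of q 1{σ > q} over the rationals q ≥ 0.
    measurable-bounded⇒generated : ∀ {σ g} → BorelMeasurable σ → 𝒢 g →
      (∀ x → 0# ≤ σ x) → (∀ x → σ x ≤ g x) → 𝒢 σ
    measurable-bounded⇒generated {σ} {g} mσ Gg 0≤σ σ≤g = pointwise (λ x → ≤-antisym (⋎≤σ x) (σ≤⋎ x))
      -- A negative rational contributes the term 0. Every term is at most σ ≤ g, so truncation at g
      -- leaves it as it is.
      (𝒢-⋎ Gg λ n → 𝒢-scale (rational n ∨ 0#) (measurable-upper-ray mσ (rational n)))
      where
      Above : ℕ → Pred (I → ℝ) 0ℓ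
      Above n x = rational n < σ x
      term : (I → ℝ) → ℕ → ℝ
      term x n = (rational n ∨ 0#) * indicator (Above n) x
      term≤σ : ∀ x n → term x n ≤ σ x
      term≤σ x n with em {P = rational n < σ x}
      ... | yes r<σ = ≤-trans (≤-reflexive (*-identityʳ _)) (∨-lub (proj₁ r<σ) (0≤σ x))
      ... | no _    = ≤-trans (≤-reflexive (zeroʳ _)) (0≤σ x)
      ⋎≤σ : ∀ x → ⋎ (g x) (term x) ≤ σ x
      ⋎≤σ x = ⋎-least (g x) (term x) (σ x) λ n → ≤-trans (x∧y≤x (term x n) (g x)) (term≤σ x n)
      σ≤⋎ : ∀ x → σ x ≤ ⋎ (g x) (term x)
      σ≤⋎ x = ≮⇒≥ λ ⋎<σ → case rational-dense ⋎<σ of λ (n , ⋎<r , r<σ) →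
        <⇒≱ ⋎<r (≤-trans (∧-glb
          (≤-trans (x≤x∨y (rational n) 0#) (≤-reflexive (sym (trans
            (cong ((rational n ∨ 0#) *_) (indicator-∈ {A = Above n} r<σ)) (*-identityʳ _)))))
          (≤-trans (proj₁ r<σ) (σ≤g x))) (⋎-upper (g x) (term x) n))

    -- Dependence on countably many coordinates

    -- The entry `nothing` allows for finite and empty lists of coordinates, hence also for an empty
    -- I.
    AgreeOn : (ℕ → Maybe I) → (I → ℝ) → (I → ℝ) → Set
    AgreeOn c x y = ∀ n i → c n ≡ just i → x i ≡ y i

    CountablyDependent : Operation I → Set
    CountablyDependent f = ∃[ c ] ∀ x y → AgreeOn c x y → f x ≡ f y

    diagonal : (ℕ → ℕ → Maybe I) → ℕ → Maybe I
    diagonal c n = c (proj₁ (unpair n)) (proj₂ (unpair n))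

    agreeOn-diagonal : ∀ {c x y} → AgreeOn (diagonal c) x y → ∀ k → AgreeOn (c k) x y
    agreeOn-diagonal {c} agree k n i e = case unpair-surjective k n of λ (l , l≡) →
      agree l i (trans (cong (λ (k , n) → c k n) l≡) e)

    generated⇒countablyDependent : ∀ {f} → 𝒢 f → CountablyDependent f
    generated⇒countablyDependent (projection i) = (λ _ → just i) , λ x y agree → agree 0 i refl
    generated⇒countablyDependent (pointwise f≗g Gf) =
      let c , dep = generated⇒countablyDependent Gf in
      c , λ x y agree → trans (sym (f≗g x)) (trans (dep x y agree) (f≗g y))
    generated⇒countablyDependent (closed {τ = σ} op f Gf) = operation op f λ i → generated⇒countablyDependent (Gf i)
      where
      operation : ∀ {K σ} → BasicOperation K σ → (f : K → Operation I) →
                  (∀ i → CountablyDependent (f i)) → CountablyDependent (λ x → σ (λ i → f i x))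
      two : {f : Fin 2 → Operation I} → (∀ i → CountablyDependent (f i)) →
            ∃[ c ] ∀ x y → AgreeOn c x y → ∀ i → f i x ≡ f i y
      two {f} dep = diagonal choice , λ x y agree → λ
        { zero       → proj₂ (dep zero) x y (agreeOn-diagonal {choice} agree 0)
        ; (suc zero) → proj₂ (dep (suc zero)) x y (agreeOn-diagonal {choice} agree 1) }
        where
        choice : ℕ → ℕ → Maybe I
        choice zero    = proj₁ (dep zero)
        choice (suc _) = proj₁ (dep (suc zero))
      operation zero-op f dep = (λ _ → nothing) , λ _ _ _ → refl
      operation one-op  f dep = (λ _ → nothing) , λ _ _ _ → refl
      operation plus-op f dep = let c , agree⇒ = two dep in
        c , λ x y agree → cong₂ _+_ (agree⇒ x y agree zero) (agree⇒ x y agree (suc zero))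
      operation join-op f dep = let c , agree⇒ = two dep in
        c , λ x y agree → cong₂ _∨_ (agree⇒ x y agree zero) (agree⇒ x y agree (suc zero))
      operation (scale-op k) f dep = let c , agree⇒ = dep zero in c , λ x y agree → cong (k *_) (agree⇒ x y agree)
      operation sup-op f dep = diagonal (proj₁ ∘ dep) , λ x y agree →
        let f≡ = λ n → proj₂ (dep n) x y (agreeOn-diagonal {proj₁ ∘ dep} agree n) in ⋎-cong (f≡ 0) (f≡ ∘ suc)

    -- f is determined by the sets {f > r} for rational r. Each has a generated indicator, which
    -- depends on countably many coordinates, and `diagonal` merges these lists.
    measurable⇒countablyDependent : ∀ {f} → BorelMeasurable f → CountablyDependent f
    measurable⇒countablyDependent {f} mf = diagonal (proj₁ ∘ dep) , λ x y agree →
        ≤-antisym (f≤ x y agree) (f≤ y x λ n i e → sym (agree n i e))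
      where
      Above : ℕ → Pred (I → ℝ) 0ℓ
      Above n x = rational n < f x
      dep : ∀ n → CountablyDependent (indicator (Above n))
      dep n = generated⇒countablyDependent (measurable-upper-ray mf (rational n))
      f≤ : ∀ x y → AgreeOn (diagonal (proj₁ ∘ dep)) x y → f x ≤ f y
      f≤ x y agree = ≮⇒≥ λ fy<fx → case rational-dense fy<fx of λ (n , fy<r , r<fx) →
        <⇒≱ fy<r (proj₁ (indicator-1⇒∈ {A = Above n} (trans (sym (proj₂ (dep n) x y
          (agreeOn-diagonal {proj₁ ∘ dep} agree n))) (indicator-∈ {A = Above n} r<fx))))

    -- Measurability from the zero measure

    nullSpace : MeasureSpace
    nullSpace = record
      { Ω          = I → ℝ
      ; F          = GeneratedSet
      ; isσAlgebra = generatedSet-isσAlgebra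
      ; μ          = λ _ → [ 0# ]
      ; μ-cong     = λ _ _ → refl
      ; μ-nonneg   = λ _ → [ ≤-refl ]
      ; μ-empty    = refl
      ; μ-additive = λ _ _ _ →
          (λ { _ (n , refl) → subst (_≤⁺ [ 0# ]) (sym (trans (sum⁺-real {n} {g = λ _ → 0#} λ _ → refl)
                                (cong [_] (sum-replicate-zero n)))) [ ≤-refl ] })
        , λ b ub → ub [ 0# ] (0 , refl)
      }

    -- Preservation is applied to the coordinate functions on ℝ^I; combining them by τ gives τ
    -- itself. All lower sums are 0, so membership in `𝓛` amounts to measurability.
    preserves⇒measurable : ∀ {p τ} → 1# ≤ p → PreservesIntegrability p τ → BorelMeasurable τ
    preserves⇒measurable {p} {τ} 1≤p preserves =
      proj₁ (preserves nullSpace (0# , refl) (λ i x → x i) λ i → N.member (generated⇒measurable (projection i)) null-bounded)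
      where
      module N = Closure nullSpace (0# , refl) p 1≤p
      null-bounded : ∀ {φ} → N.LowerSumsBounded φ
      null-bounded = 0# , λ s _ → ≤-reflexive (trans (sum-cong-≗ {N.size s} λ i → zeroʳ (N.coeff s i)) (sum-replicate-zero (N.size s)))

  -- Weighted counting measures

  Σ< : (ℕ → ℝ) → ℕ → ℝ
  Σ< f zero    = 0#
  Σ< f (suc N) = Σ< f N + f N

  Σ<-mono : ∀ {f g} N → (∀ n → n ℕ.< N → f n ≤ g n) → Σ< f N ≤ Σ< g N
  Σ<-mono zero    f≤g = ≤-refl
  Σ<-mono (suc N) f≤g = +-mono (Σ<-mono N λ n n<N → f≤g n (ℕ.m≤n⇒m≤1+n n<N)) (f≤g N ℕ.≤-refl)

  monotone : ∀ {a : ℕ → ℝ} → (∀ N → a N ≤ a (suc N)) → ∀ k N → a N ≤ a (k ℕ.+ N)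
  monotone step zero    N = ≤-refl
  monotone step (suc k) N = ≤-trans (monotone step k N) (step (k ℕ.+ N))

  IsSupremum : (ℕ → ℝ) → ℝ → Set
  IsSupremum a = IsLub _≤_ (λ r → ∃[ N ] r ≡ a N)

  -- Increasing sequences allow separate stages: stage M of the first sequence and stage N of the
  -- others are all dominated at stage M + N. The supremum over N is taken by induction, then the
  -- one over M.
  sum-suprema≤ : ∀ {k} (a : Fin k → ℕ → ℝ) (L : Fin k → ℝ) → (∀ i N → a i N ≤ a i (suc N)) →
    (∀ i → IsSupremum (a i) (L i)) → ∀ C → (∀ N → sum (λ i → a i N) ≤ C) → sum L ≤ C
  sum-suprema≤ {zero}  a L step lub C bound = bound 0
  sum-suprema≤ {suc k} a L step lub C bound = lin₁ L₀≤
      (solve 3 (λ l s c → c :+ :- (l :+ s) := c :+ :- s :+ :- l) refl (L zero) (sum (L ∘ suc)) C)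
    where
    rest : ∀ M → sum (L ∘ suc) ≤ C + - a zero M
    rest M = sum-suprema≤ (a ∘ suc) (L ∘ suc) (step ∘ suc) (lub ∘ suc) (C + - a zero M) λ N →
      lin₂ (bound (M ℕ.+ N)) (+-mono (subst (λ K → a zero M ≤ a zero K) (ℕ.+-comm N M) (monotone (step zero) N M))
                                     (sum-mono {f = λ i → a (suc i) N} {λ i → a (suc i) (M ℕ.+ N)} λ i → monotone (step (suc i)) M N))
        (solve 5 (λ c a₀ r a₁ r₁ → c :+ :- a₀ :+ :- r := c :+ :- (a₁ :+ r₁) :+ (a₁ :+ r₁ :+ :- (a₀ :+ r))) refl
          C (a zero M) (sum (λ i → a (suc i) N)) (a zero (M ℕ.+ N)) (sum (λ i → a (suc i) (M ℕ.+ N))))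
    L₀≤ : L zero ≤ C + - sum (L ∘ suc)
    L₀≤ = proj₂ (lub zero) _ λ { _ (M , refl) → lin₁ (rest M)
      (solve 3 (λ c s a → c :+ :- s :+ :- a := c :+ :- a :+ :- s) refl C (sum (L ∘ suc)) (a zero M)) }

  supremum-scale : ∀ {a L c} → 0# < c → IsSupremum a L → IsSupremum (λ N → c * a N) (c * L)
  supremum-scale {a} {L} {c} 0<c (upper , least) =
    (λ { _ (N , refl) → *-monoˡ (proj₁ 0<c) (upper _ (N , refl)) }) ,
    λ b ub → ≤-trans (*-monoˡ (proj₁ 0<c) (least (r * b) λ { _ (N , refl) →
      *-cancelˡ-≤ 0<c (≤-trans (ub _ (N , refl)) (≤-reflexive (sym (recip-cancel 0<c b)))) })) (≤-reflexive (recip-cancel 0<c b))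
    where
    r = proj₁ (recip 0<c)

  Disjoint : ∀ {k} {X : Set} → (Fin k → Pred X 0ℓ) → Set
  Disjoint P = ∀ i j → i ≢ j → P i ⊥ P j

  -- At most one term is nonzero. Once a piece contains x, the remaining sum is bounded by 0.
  sum-indicators≤ : ∀ {k} {X : Set} (c : Fin k → ℝ) (P : Fin k → Pred X 0ℓ) → Disjoint P → ∀ {x y} →
    0# ≤ y → (∀ i → P i x → c i ≤ y) → sum (λ i → c i * indicator (P i) x) ≤ y
  sum-indicators≤ {zero}  c P disj 0≤y c≤y = 0≤y
  sum-indicators≤ {suc k} c P disj {x} {y} 0≤y c≤y with em {P = P zero x}
  ... | yes p₀ = ≤-trans (+-mono (≤-trans (≤-reflexive (*-identityʳ _)) (c≤y zero p₀))
      (sum-indicators≤ (c ∘ suc) (P ∘ suc) (λ i j i≢j → disj (suc i) (suc j) (i≢j ∘ Fin.suc-injective))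
        ≤-refl λ i p → ⊥-elim (disj zero (suc i) (λ ()) (p₀ , p)))) (≤-reflexive (+-identityʳ y))
  ... | no _ = ≤-trans (+-mono (≤-reflexive (zeroʳ _))
      (sum-indicators≤ (c ∘ suc) (P ∘ suc) (λ i j i≢j → disj (suc i) (suc j) (i≢j ∘ Fin.suc-injective))
        0≤y (c≤y ∘ suc))) (≤-reflexive (+-identityˡ y))

  term≤sum : ∀ {k} {f : Fin k → ℝ} → (∀ i → 0# ≤ f i) → ∀ i → f i ≤ sum f
  sum-nonneg : ∀ {k} {f : Fin k → ℝ} → (∀ i → 0# ≤ f i) → 0# ≤ sum f
  sum-nonneg {zero}  0≤f = ≤-refl
  sum-nonneg {suc k} 0≤f = +-nonneg (0≤f zero) (sum-nonneg (0≤f ∘ suc))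
  term≤sum {f = f} 0≤f zero    = subst (_≤ sum f) (+-identityʳ _) (+-mono ≤-refl (sum-nonneg (0≤f ∘ suc)))
  term≤sum {f = f} 0≤f (suc i) = subst (_≤ sum f) (+-identityˡ _) (+-mono (0≤f zero) (term≤sum (0≤f ∘ suc) i))

  ⌜n⌝≤sum : ∀ {n} {f : Fin n → ℝ} → (∀ i → 1# ≤ f i) → ⌜ n ⌝ ≤ sum f
  ⌜n⌝≤sum {zero}  1≤f = ≤-refl
  ⌜n⌝≤sum {suc n} 1≤f = +-mono (1≤f zero) (⌜n⌝≤sum (1≤f ∘ suc))

  module Weighted (w : ℕ → ℝ) (0≤w : ∀ n → 0# ≤ w n) (bound : ℝ) (Σw≤ : ∀ N → Σ< w N ≤ bound) where

    partial : Pred ℕ 0ℓ → ℕ → ℝ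
    partial A = Σ< λ n → w n * indicator A n

    partial-step : ∀ A N → partial A N ≤ partial A (suc N)
    partial-step A N = subst (_≤ partial A (suc N)) (+-identityʳ _)
      (+-mono ≤-refl (*-nonneg (0≤w N) (indicator-nonneg A N)))

    partial≤bound : ∀ A N → partial A N ≤ bound
    partial≤bound A N = ≤-trans (Σ<-mono N λ n _ → ≤-trans (*-monoˡ (0≤w n) (indicator≤1 n))
        (≤-reflexive (*-identityʳ (w n)))) (Σw≤ N)
      where
      indicator≤1 : ∀ n → indicator A n ≤ 1#
      indicator≤1 n with em {P = A n}
      ... | yes _ = ≤-refl
      ... | no _  = 0≤1

    mass : Pred ℕ 0ℓ → ℝ
    mass A = sup λ r → ∃[ N ] r ≡ partial A N

    mass-isSupremum : ∀ A → IsSupremum (partial A) (mass A)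
    mass-isSupremum A = sup-isLub _ (0# , 0 , refl) (bound , λ { _ (N , refl) → partial≤bound A N })

    partial≤mass : ∀ A N → partial A N ≤ mass A
    partial≤mass A N = proj₁ (mass-isSupremum A) _ (N , refl)

    sum-partial : ∀ {k} (c : Fin k → ℝ) (P : Fin k → Pred ℕ 0ℓ) N →
      sum (λ i → c i * partial (P i) N) ≡ Σ< (λ n → w n * sum (λ i → c i * indicator (P i) n)) N
    sum-partial {k} c P zero    = trans (sum-cong-≗ {k} λ i → zeroʳ (c i)) (sum-replicate-zero k)
    sum-partial {k} c P (suc N) = trans
      (sum-cong-≗ {k} λ i → solve 4 (λ c s w x → c :* (s :+ w :* x) := c :* s :+ w :* (c :* x)) refl
        (c i) (partial (P i) N) (w N) (indicator (P i) N))
      (trans (∑-distrib-+ {k} (λ i → c i * partial (P i) N) (λ i → w N * (c i * indicator (P i) N)))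
        (cong₂ _+_ (sum-partial c P N) (sym (*-distribˡ-sum {k} (w N) (λ i → c i * indicator (P i) N)))))

    -- The common estimate for two purposes: with coefficients 1 and φ the indicator of a union it
    -- gives one half of additivity, and with arbitrary coefficients it bounds the lower sums of φ.
    sum-mass≤ : ∀ {k} (c : Fin k → ℝ) (P : Fin k → Pred ℕ 0ℓ) → (∀ i → 0# < c i) → Disjoint P →
      ∀ {φ : ℕ → ℝ} {C} → (∀ n → 0# ≤ φ n) → (∀ i n → P i n → c i ≤ φ n) →
      (∀ N → Σ< (λ n → w n * φ n) N ≤ C) → sum (λ i → c i * mass (P i)) ≤ C
    sum-mass≤ {k} c P 0<c disj {φ} {C} 0≤φ c≤φ Σwφ≤ = sum-suprema≤ {k} (λ i N → c i * partial (P i) N) (λ i → c i * mass (P i))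
      (λ i N → *-monoˡ (proj₁ (0<c i)) (partial-step (P i) N))
      (λ i → supremum-scale (0<c i) (mass-isSupremum (P i))) C
      λ N → ≤-trans (≤-reflexive (sum-partial c P N)) (≤-trans
        (Σ<-mono N λ n _ → *-monoˡ (0≤w n) (sum-indicators≤ c P disj (0≤φ n) λ i → c≤φ i n)) (Σwφ≤ N))

    1*-sum : ∀ {k} (f : Fin k → ℝ) → sum (λ i → 1# * f i) ≡ sum f
    1*-sum {k} f = sum-cong-≗ {k} λ i → *-identityˡ (f i)

    mass-cong : ∀ {A B} → A ≐ B → mass A ≡ mass B
    mass-cong {A} {B} (A⊆B , B⊆A) = lub-unique (mass-isSupremum A) (mass-isSupremum B)
      ( (λ { (N , refl) → N , partial≡ N }) , (λ { (N , refl) → N , sym (partial≡ N) }))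
      where
      partial≡ : ∀ N → partial A N ≡ partial B N
      partial≡ zero    = refl
      partial≡ (suc N) = cong₂ (λ s x → s + w N * x) (partial≡ N) (indicator-unique {A = B}
        (λ b → indicator-∈ {A = A} (B⊆A b)) (λ ¬b → indicator-∉ {A = A} (¬b ∘ A⊆B)))

    mass-∅ : mass ∅ ≡ 0#
    mass-∅ = ≤-antisym (proj₂ (mass-isSupremum ∅) 0# λ { _ (N , refl) → ≤-reflexive (partial≡0 N) }) (partial≤mass ∅ 0)
      where
      partial≡0 : ∀ N → partial ∅ N ≡ 0#
      partial≡0 zero    = refl
      partial≡0 (suc N) = trans (cong₂ (λ s x → s + w N * x) (partial≡0 N) (indicator-∉ {A = ∅} λ ()))
        (solve 1 (λ w → :0 :+ w :* :0 := :0) refl (w N))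

    module _ (A : ℕ → Pred ℕ 0ℓ) (disjoint : ∀ m n → m ≢ n → A m ⊥ A n) where
      initial-disjoint : ∀ K → Disjoint {K} (A ∘ toℕ)
      initial-disjoint K i j i≢j = disjoint (toℕ i) (toℕ j) (i≢j ∘ Fin.toℕ-injective)

      additive-upper : ∀ K → sum {K} (λ i → mass (A (toℕ i))) ≤ mass (⋃ ℕ A)
      additive-upper K = subst (_≤ mass (⋃ ℕ A)) (1*-sum {K} λ i → mass (A (toℕ i)))
        (sum-mass≤ (λ _ → 1#) (A ∘ toℕ) (λ _ → 0<1) (initial-disjoint K) (indicator-nonneg (⋃ ℕ A))
          (λ i n a → ≤-reflexive (sym (indicator-∈ {A = ⋃ ℕ A} (toℕ i , a)))) (partial≤mass (⋃ ℕ A)))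

      -- Each of the finitely many points below N that lie in the union belongs to some A k, and K
      -- is chosen above all these k.
      initial-cover : ∀ N → ∃[ K ] ∀ n → n ℕ.< N → ⋃ ℕ A n → ∃[ i ] A (toℕ {K} i) n
      initial-cover zero = 0 , λ _ ()
      initial-cover (suc N) = extend (initial-cover N) em
        where
        extend : (∃[ K ] ∀ n → n ℕ.< N → ⋃ ℕ A n → ∃[ i ] A (toℕ {K} i) n) → Dec (⋃ ℕ A N) →
                 ∃[ K ] ∀ n → n ℕ.< suc N → ⋃ ℕ A n → ∃[ i ] A (toℕ {K} i) n
        extend (K , cover) (no ∉) = K , λ n n<1+N a → [ (λ n<N → cover n n<N a) , (λ { refl → contradiction a ∉ }) ]′
                                        (ℕ.m<1+n⇒m<n∨m≡n n<1+N)
        extend (K , cover) (yes (k , Ak)) = K ℕ.+ suc k , λ n n<1+N a →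
          [ (λ n<N → let i , Ai = cover n n<N a in
               i Fin.↑ˡ suc k , subst (λ l → A l n) (sym (Fin.toℕ-↑ˡ i (suc k))) Ai)
          , (λ { refl → Fin.fromℕ< k<K+1+k , subst (λ l → A l n) (sym (Fin.toℕ-fromℕ< k<K+1+k)) Ak }) ]′
          (ℕ.m<1+n⇒m<n∨m≡n n<1+N)
          where
          k<K+1+k : k ℕ.< K ℕ.+ suc k
          k<K+1+k = ℕ.m≤n+m (suc k) K

      -- A partial sum of length N sees only points below N, and by `initial-cover` finitely many of
      -- the sets contain those that lie in the union.
      additive-least : ∀ b → (∀ K → sum {K} (λ i → mass (A (toℕ i))) ≤ b) → mass (⋃ ℕ A) ≤ b
      additive-least b ub = proj₂ (mass-isSupremum (⋃ ℕ A)) b λ { _ (N , refl) →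
        let K , cover = initial-cover N in
        ≤-trans (Σ<-mono N λ n n<N → *-monoˡ (0≤w n) (indicator≤ K n (cover n n<N)))
        (≤-trans (≤-reflexive (sym (sum-partial {K} (λ _ → 1#) (A ∘ toℕ) N)))
        (≤-trans (≤-reflexive (1*-sum {K} λ i → partial (A (toℕ i)) N)) (≤-trans (sum-mono {K} λ i → partial≤mass (A (toℕ i)) N) (ub K)))) }
        where
        indicator≤ : ∀ K n → (⋃ ℕ A n → ∃[ i ] A (toℕ {K} i) n) →
                     indicator (⋃ ℕ A) n ≤ sum {K} (λ i → 1# * indicator (A (toℕ i)) n)
        indicator≤ K n cover with em {P = ⋃ ℕ A n}
        ... | no _  = sum-nonneg {K} λ i → *-nonneg 0≤1 (indicator-nonneg (A (toℕ i)) n)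
        ... | yes a = let i , Ai = cover a in
          ≤-trans (≤-reflexive (trans (sym (indicator-∈ {A = A (toℕ i)} Ai)) (sym (*-identityˡ _))))
            (term≤sum {K} (λ i → *-nonneg 0≤1 (indicator-nonneg (A (toℕ i)) n)) i)

    Everything : Pred (Pred ℕ 0ℓ) (lsuc 0ℓ)
    Everything _ = Lift (lsuc 0ℓ) ⊤

    weightedSpace : MeasureSpace
    weightedSpace = record
      { Ω          = ℕ
      ; F          = Everything
      ; isσAlgebra = record { F-respects = λ _ _ → lift tt ; F-whole = lift tt
                            ; F-complement = λ _ → lift tt ; F-union = λ _ _ → lift tt }
      ; μ          = λ A → [ mass A ]
      ; μ-cong     = λ _ A≐B → cong [_] (mass-cong A≐B)
      ; μ-nonneg   = λ {A} _ → [ partial≤mass A 0 ]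
      ; μ-empty    = cong [_] mass-∅
      ; μ-additive = λ A _ disj →
          (λ { _ (K , refl) → subst (_≤⁺ [ mass (⋃ ℕ A) ]) (sym (partial-sum A K)) [ additive-upper A disj K ] })
        , λ { ⊤⁺ _ → _ ≤⊤⁺
            ; [ b ] ub → [ additive-least A disj b (λ K → [≤]-injective
                (subst (_≤⁺ [ b ]) (partial-sum A K) (ub _ (K , refl)))) ] }
      }
      where
      partial-sum : ∀ A K → sum⁺ {K} (λ i → [ mass (A (toℕ i)) ]) ≡ [ sum {K} (λ i → mass (A (toℕ i))) ]
      partial-sum A K = sum⁺-real {K} λ _ → refl

    weightedSpace-finite : Finite weightedSpace
    weightedSpace-finite = mass U , refl

    open FiniteMeasure weightedSpace weightedSpace-finite using (LowerSumsBounded; coeff; piece; coeff-positive; piece-disjoint)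

    weighted-bounded : ∀ {φ : ℕ → ℝ} {C} → (∀ n → 0# ≤ φ n) → (∀ N → Σ< (λ n → w n * φ n) N ≤ C) → LowerSumsBounded φ
    weighted-bounded {C = C} 0≤φ Σwφ≤ = C , λ s s≤φ →
      sum-mass≤ (coeff s) (piece s) (coeff-positive s) (piece-disjoint s) 0≤φ s≤φ Σwφ≤

    w≤mass : ∀ n → w n ≤ mass (_≡ n)
    w≤mass n = ≤-trans (subst₂ _≤_ (+-identityˡ (w n))
      (cong (partial (_≡ n) n +_) (sym (trans (cong (w n *_) (indicator-∈ {A = _≡ n} refl)) (*-identityʳ (w n)))))
      (+-mono (0≤partial n) ≤-refl)) (partial≤mass (_≡ n) (suc n))
      where
      0≤partial : ∀ N → 0# ≤ partial (_≡ n) N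
      0≤partial zero    = ≤-refl
      0≤partial (suc N) = ≤-trans (0≤partial N) (partial-step (_≡ n) N)

    -- The simple function with values φ n on the singletons {n}, n < N, has integral at least N.
    weighted-unbounded : ∀ {φ : ℕ → ℝ} → (∀ n → 0# < φ n) → (∀ n → 1# ≤ φ n * w n) → ¬ LowerSumsBounded φ
    weighted-unbounded {φ} 0<φ 1≤φw (C , b) = let N , C<N = archimedean C in
      <⇒≱ C<N (≤-trans (⌜n⌝≤sum {N} λ i → ≤-trans (1≤φw (toℕ i)) (*-monoˡ (proj₁ (0<φ (toℕ i))) (w≤mass (toℕ i))))
                       (b (atoms N) λ { i _ refl → ≤-refl }))
      where
      atoms : ℕ → SimpleFunction weightedSpace
      atoms N = record
        { size             = N
        ; coeff            = φ ∘ toℕ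
        ; piece            = λ i → _≡ toℕ i
        ; coeff-positive   = 0<φ ∘ toℕ
        ; piece-measurable = λ _ → lift tt
        ; piece-disjoint   = λ { i j i≢j (refl , e) → i≢j (Fin.toℕ-injective e) }
        }

  -- Linear growth of the operations preserving integrability

  ½ : ℝ
  ½ = proj₁ (recip 0<2)

  2*½≡1 : 2# * ½ ≡ 1#
  2*½≡1 = proj₂ (proj₂ (recip 0<2))

  0≤½^ : ∀ n → 0# ≤ ½ ^ n
  0≤½^ n = ^-nonneg n (proj₁ (proj₁ (proj₂ (recip 0<2))))

  Σ½^≤2 : ∀ N → Σ< (½ ^_) N ≤ 2#
  Σ½^≤2 N = ≤-trans (lin₁ (*-nonneg (proj₁ 0<2) (0≤½^ N))
      (solve 2 (λ s d → s :+ d :+ :- s := d :+ :- :0) refl (Σ< (½ ^_) N) (2# * ½ ^ N))) (≤-reflexive (total-sum N))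
    where
    -- The invariant behind the geometric series: the remaining tail is twice the next term.
    total-sum : ∀ N → Σ< (½ ^_) N + 2# * ½ ^ N ≡ 2#
    total-sum zero    = trans (+-identityˡ _) (*-identityʳ 2#)
    total-sum (suc N) = begin
      Σ< (½ ^_) N + ½ ^ N + 2# * (½ * ½ ^ N)   ≡⟨ cong (Σ< (½ ^_) N + ½ ^ N +_) (*-assoc 2# ½ (½ ^ N)) ⟨
      Σ< (½ ^_) N + ½ ^ N + 2# * ½ * ½ ^ N     ≡⟨ cong (λ z → Σ< (½ ^_) N + ½ ^ N + z * ½ ^ N) 2*½≡1 ⟩
      Σ< (½ ^_) N + ½ ^ N + 1# * ½ ^ N         ≡⟨ solve 2 (λ s h → s :+ h :+ :1 :* h := s :+ (:1 :+ :1) :* h) refl (Σ< (½ ^_) N) (½ ^ N) ⟩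
      Σ< (½ ^_) N + 2# * ½ ^ N                 ≡⟨ total-sum N ⟩
      2#                                       ∎
      where open ≡-Reasoning

  runningMax : ℝ → (ℕ → ℝ) → ℕ → ℝ
  runningMax b f zero    = b
  runningMax b f (suc n) = runningMax b f n ∨ f n

  base≤runningMax : ∀ b f n → b ≤ runningMax b f n
  base≤runningMax b f zero    = ≤-refl
  base≤runningMax b f (suc n) = ≤-trans (base≤runningMax b f n) (x≤x∨y _ (f n))

  term≤runningMax : ∀ b f {k n} → k ℕ.< n → f k ≤ runningMax b f n
  term≤runningMax b f {k} {suc n} k<1+n = [ (λ k<n → ≤-trans (term≤runningMax b f k<n) (x≤x∨y _ (f n)))
    , (λ { refl → y≤x∨y _ (f n) }) ]′ (ℕ.m<1+n⇒m<n∨m≡n k<1+n)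

  runningMax-cong : ∀ b {f g} → (∀ k → f k ≡ g k) → ∀ n → runningMax b f n ≡ runningMax b g n
  runningMax-cong b f≗g zero    = refl
  runningMax-cong b f≗g (suc n) = cong₂ _∨_ (runningMax-cong b f≗g n) (f≗g n)

  module Growth {I : Set} (p : ℝ) (1≤p : 1# ≤ p) (τ : Operation I) (preserves : PreservesIntegrability p τ)
    (c : ℕ → Maybe I) (τ-agree : ∀ x y → Generation.AgreeOn c x y → τ x ≡ τ y) where
    open Generation {I}

    size-at : (I → ℝ) → Maybe I → ℝ
    size-at x = maybe′ (λ i → ∣ x i ∣) 0#

    u : ℕ → Operation I
    u n x = runningMax 1# (λ k → size-at x (c k)) n

    1≤u : ∀ n x → 1# ≤ u n x
    1≤u n x = base≤runningMax 1# _ n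

    𝒢-u : ∀ n → 𝒢 (u n)
    𝒢-u zero    = 𝒢-1
    𝒢-u (suc n) = 𝒢-∨ (𝒢-u n) (𝒢-size-at (c n))
      where
      𝒢-size-at : ∀ i → 𝒢 (λ x → size-at x i)
      𝒢-size-at (just i) = 𝒢-|| (projection i)
      𝒢-size-at nothing  = 𝒢-const 0#

    u-agree : ∀ {x y} → AgreeOn c x y → ∀ n → u n x ≡ u n y
    u-agree {x} {y} agree = runningMax-cong 1# λ k → same k (c k) refl
      where
      same : ∀ k i → c k ≡ i → size-at x i ≡ size-at y i
      same k (just i) e = cong ∣_∣ (agree k i e)
      same k nothing  e = refl

    -- `u` does not control the coordinates off the list. As τ does not see them, they can be made
    -- integrable by setting them to 0.
    truncate : (I → ℝ) → I → ℝ
    truncate x i with em {P = ∃[ k ] c k ≡ just i}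
    ... | yes _ = x i
    ... | no _  = 0#

    truncate-agree : ∀ x → AgreeOn c x (truncate x)
    truncate-agree x k i e with em {P = ∃[ k ] c k ≡ just i}
    ... | yes _ = refl
    ... | no ∉  = contradiction (k , e) ∉

    truncate-outside : ∀ x i → ¬ (∃[ k ] c k ≡ just i) → truncate x i ≡ 0#
    truncate-outside x i ∉ with em {P = ∃[ k ] c k ≡ just i}
    ... | yes ∈ = contradiction ∈ ∉
    ... | no _  = refl

    module Unbounded (x : ℕ → I → ℝ) (outgrows : ∀ n → 2# ^ n * u n (x n) < ∣ τ (x n) ∣) where
      open RealPower p 1≤p

      z : ℕ → I → ℝ
      z n = truncate (x n)

      g T W : ℕ → ℝ
      g n = u n (z n)
      T n = ∣ τ (z n) ∣
      W n = T n ^ʳ p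

      2ⁿg≤T : ∀ n → 2# ^ n * g n ≤ T n
      2ⁿg≤T n = proj₁ (subst₂ (λ v t → 2# ^ n * v < ∣ t ∣) (u-agree (truncate-agree (x n)) n)
        (τ-agree _ _ (truncate-agree (x n))) (outgrows n))

      1≤2ⁿg : ∀ n → 1# ≤ 2# ^ n * g n
      1≤2ⁿg n = subst (_≤ 2# ^ n * g n) (*-identityˡ 1#)
        (*-mono 0≤1 (≤-trans 0≤1 (1≤u n (z n))) (1≤^ n 1≤2) (1≤u n (z n)))

      0<W : ∀ n → 0# < W n
      0<W n = <-≤-trans 0<1 (1≤x^ʳp (≤-trans (1≤2ⁿg n) (2ⁿg≤T n)))

      w : ℕ → ℝ
      w n = proj₁ (recip (0<W n))

      0≤w : ∀ n → 0# ≤ w n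
      0≤w n = proj₁ (proj₁ (proj₂ (recip (0<W n))))

      -- By 2ⁿ gᵖ ≤ (2ⁿ g)ᵖ ≤ Tᵖ = 1 / w, where the first inequality rests on p ≥ 1.
      wgᵖ≤½ⁿ : ∀ n → w n * g n ^ʳ p ≤ ½ ^ n
      wgᵖ≤½ⁿ n = *-cancelˡ-≤ (^-pos n 0<2) (begin
        2# ^ n * (w n * g n ^ʳ p)      ≡⟨ solve 3 (λ t w g → t :* (w :* g) := w :* (t :* g)) refl (2# ^ n) (w n) (g n ^ʳ p) ⟩
        w n * (2# ^ n * g n ^ʳ p)      ≤⟨ *-monoˡ (0≤w n) (^ʳ-double^-≥ n (1≤u n (z n))) ⟩
        w n * (2# ^ n * g n) ^ʳ p      ≤⟨ *-monoˡ (0≤w n) (^ʳ-mono (1≤2ⁿg n) (2ⁿg≤T n)) ⟩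
        w n * W n                      ≡⟨ *-comm (w n) (W n) ⟩
        W n * w n                      ≡⟨ proj₂ (proj₂ (recip (0<W n))) ⟩
        1#                             ≡⟨ 1^n≡1 n ⟨
        1# ^ n                         ≡⟨ cong (_^ n) 2*½≡1 ⟨
        (2# * ½) ^ n                   ≡⟨ ^-distrib-* 2# ½ n ⟩
        2# ^ n * ½ ^ n                 ∎)
        where open ≤-Reasoning

      -- This makes the weighted space finite. It follows from g ≥ 1, which is why `u` starts from
      -- 1.
      w≤½ⁿ : ∀ n → w n ≤ ½ ^ n
      w≤½ⁿ n = ≤-trans (≤-trans (≤-reflexive (sym (*-identityʳ (w n))))
        (*-monoˡ (0≤w n) (1≤x^ʳp (1≤u n (z n))))) (wgᵖ≤½ⁿ n)

      open Weighted w 0≤w 2# (λ N → ≤-trans (Σ<-mono N λ n _ → w≤½ⁿ n) (Σ½^≤2 N))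
      open Closure weightedSpace weightedSpace-finite p 1≤p
        using (member; 𝓛-const; 𝓛-respects; 𝓛-dominated; integral⇒bounded)

      1∨|g|≡g : ∀ n → 1# ∨ ∣ g n ∣ ≡ g n
      1∨|g|≡g n = ≤-antisym (∨-lub (1≤u n (z n)) (≤-reflexive |g|≡g)) (≤-trans (x≤|x| (g n)) (y≤x∨y 1# _))
        where
        |g|≡g : ∣ g n ∣ ≡ g n
        |g|≡g = |x|≡x (≤-trans 0≤1 (1≤u n (z n)))

      g∈𝓛 : 𝓛 weightedSpace p g
      g∈𝓛 = member (λ _ _ → lift tt) (weighted-bounded
        (λ n → ≤-trans 0≤1 (1≤x^ʳp (x≤x∨y 1# _)))
        λ N → ≤-trans (Σ<-mono N λ n _ → ≤-trans (≤-reflexive (cong (λ v → w n * v ^ʳ p) (1∨|g|≡g n))) (wgᵖ≤½ⁿ n)) (Σ½^≤2 N))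

      outside∈𝓛 : ∀ i → ¬ (∃[ k ] c k ≡ just i) → 𝓛 weightedSpace p (λ n → z n i)
      outside∈𝓛 i ∉ = 𝓛-respects {λ _ → 0#} {λ n → z n i} (λ n → sym (truncate-outside (x n) i ∉)) (𝓛-const 0#)

      -- For n > k the coordinate is among those that g n bounds; the finitely many values with n ≤
      -- k are bounded by a constant.
      relevant∈𝓛 : ∀ i k → c k ≡ just i → 𝓛 weightedSpace p (λ n → z n i)
      relevant∈𝓛 i k e = 𝓛-dominated {λ _ → b} {g} {λ n → z n i} (𝓛-const b) g∈𝓛 (λ _ _ → lift tt) λ n →
          [ late n , early n ]′ (ℕ.<-≤-connex k n)
        where
        b : ℝ
        -- The length is `suc k` because `runningMax` at n covers only the indices below n.
        b = runningMax 0# (λ n → ∣ z n i ∣) (suc k)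
        late : ∀ n → k ℕ.< n → ∣ z n i ∣ ≤ ∣ b ∣ ∨ ∣ g n ∣
        late n k<n = ≤-trans (subst (_≤ g n) (cong (size-at (z n)) e)
            (term≤runningMax 1# (λ k → size-at (z n) (c k)) k<n))
          (≤-trans (x≤|x| (g n)) (y≤x∨y (∣ b ∣) (∣ g n ∣)))
        early : ∀ n → n ℕ.≤ k → ∣ z n i ∣ ≤ ∣ b ∣ ∨ ∣ g n ∣
        early n n≤k = ≤-trans (term≤runningMax 0# (λ n → ∣ z n i ∣) (s≤s n≤k))
          (≤-trans (x≤|x| b) (x≤x∨y (∣ b ∣) (∣ g n ∣)))

      coordinate∈𝓛 : ∀ i → 𝓛 weightedSpace p (λ n → z n i)
      coordinate∈𝓛 i = by-cases em
        where
        by-cases : Dec (∃[ k ] c k ≡ just i) → 𝓛 weightedSpace p (λ n → z n i)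
        by-cases (yes (k , e)) = relevant∈𝓛 i k e
        by-cases (no ∉)        = outside∈𝓛 i ∉

      absurd : Empty.⊥
      -- Each point n contributes `W n * w n`, which is 1, to the integral of |τ|ᵖ.
      absurd = weighted-unbounded 0<W (λ n → ≤-reflexive (sym (proj₂ (proj₂ (recip (0<W n))))))
        (integral⇒bounded (proj₂ (proj₂ (preserves weightedSpace weightedSpace-finite (λ i n → z n i) coordinate∈𝓛))))

    -- One index N governs both the constant 2ᴺ and the number of coordinates, so that failure of
    -- the bound for every N directly supplies the sequence of points.
    growth-bound : ∃[ h ] 𝒢 h × (∀ x → ∣ τ x ∣ ≤ h x)
    growth-bound with em {P = ∃[ N ] ∀ x → ∣ τ x ∣ ≤ 2# ^ N * u N x}
    ... | yes (N , |τ|≤) = (λ x → 2# ^ N * u N x) , 𝒢-scale (2# ^ N) (𝒢-u N) , |τ|≤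
    ... | no none        = ⊥-elim (Unbounded.absurd (λ n → proj₁ (witness n)) (λ n → proj₂ (witness n)))
      where
      witness : ∀ N → ∃[ x ] 2# ^ N * u N x < ∣ τ x ∣
      witness N with em {P = ∃[ x ] 2# ^ N * u N x < ∣ τ x ∣}
      ... | yes found = found
      ... | no none′  = contradiction (N , λ x → ≮⇒≥ λ lt → none′ (x , lt)) none

  -- From measurability and linear growth to generation

  preserves⇒generated : ∀ {I p} {τ : Operation I} → 1# ≤ p → PreservesIntegrability p τ → Generated BasicOperation τ
  preserves⇒generated {I} {p} {τ} 1≤p preserves =
    case measurable⇒countablyDependent τ-measurable of λ (c , τ-agree) →
    case growth-bound p 1≤p τ preserves c τ-agree of λ (h , 𝒢-h , |τ|≤h) → shift h 𝒢-h |τ|≤h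
    where
    open Generation {I}
    open Growth
    τ-measurable : BorelMeasurable τ
    τ-measurable = preserves⇒measurable 1≤p preserves
    -- τ + h lies between 0 and h + h, so it is generated, and h can be subtracted again.
    shift : ∀ h → 𝒢 h → (∀ x → ∣ τ x ∣ ≤ h x) → 𝒢 τ
    shift h 𝒢-h |τ|≤h = pointwise (λ x → solve 2 (λ t h → t :+ h :+ :- h := t) refl (τ x) (h x))
        (𝒢-+ {λ x → τ x + h x} {λ x → - h x} (measurable-bounded⇒generated {λ x → τ x + h x} {λ x → h x + h x}
          (measurable-+ {τ} {h} τ-measurable (generated⇒measurable 𝒢-h)) (𝒢-+ 𝒢-h 𝒢-h) 0≤τ+h
          λ x → +-mono (≤-trans (x≤|x| (τ x)) (|τ|≤h x)) ≤-refl) (𝒢-neg 𝒢-h))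
      where
      0≤τ+h : ∀ x → 0# ≤ τ x + h x
      0≤τ+h x = lin₁ (≤-trans (-x≤|x| (τ x)) (|τ|≤h x))
        (solve 2 (λ t h → t :+ h :+ :- :0 := h :+ :- (:- t)) refl (τ x) (h x))

theorem2p4 : (em : ∀ {ℓ} → ExcludedMiddle ℓ) (R : CompleteOrderedField) →
    let open Analysis em R in
    (p : ℝ) → 1# ≤ p →
    (I : Set) (τ : Operation I) →
    PreservesIntegrability p τ ⇔ Generated BasicOperation τ
theorem2p4 em R p 1≤p I τ = mk⇔ (preserves⇒generated 1≤p) (generated⇒preserves 1≤p)
  where open Proof em R
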